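{- Let $k\geq 2$ be an even integer, and let $G$ be a connected graph with minimum degree $\delta\geq k+1$ and order $$n\geq\max\left\{\frac{(\delta^{2}+(2-k)\delta-2k-1)^{2}}{6(\delta-k)}+\delta+k+1,\ \delta^{2}+4\delta-k^{2}+6\right\}.$$ If $$e(G)\geq e\bigl(K_{\delta}\vee(K_{n-(\delta-k+1)\delta-1}\cup((\delta-k)\delta+1)K_1)\bigr),$$ then $G$ has the $k$-strong parity property unless $G=K_{\delta}\vee(K_{n-(\delta-k+1)\delta-1}\cup((\delta-k)\delta+1)K_1)$ (equality of graphs being understood up to isomorphism).
   Context: All graphs are finite, undirected and simple. For a graph $G$, $V(G)$ is its vertex set, its order is $n=|V(G)|$, its size $e(G)$ is its number of edges, $d_G(v)$ is the degree of the vertex $v$ in $G$, and $\delta=\delta(G)$ is the minimum degree of $G$. $K_m$ is the complete graph on $m$ vertices. $G_1\cup G_2$ denotes the union of two vertex-disjoint graphs, $mK_1$ denotes the disjoint union of $m$ copies of $K_1$ (i.e. $m$ isolated vertices), and the join $G_1\vee G_2$ of two vertex-disjoint graphs is obtained from $G_1\cup G_2$ by adding all edges joining a vertex of $G_1$ to a vertex of $G_2$. For an even integer $k\geq 2$, a graph $G$ has the $k$-strong parity property if for every $X\subseteq V(G)$ with $|X|$ even, $G$ contains a spanning subgraph $F$ (a subgraph with $V(F)=V(G)$) such that $d_F(u)\equiv 1 \pmod 2$ for each $u\in X$ and $d_F(v)\in\{k,k+2,k+4,\ldots\}$ for each $v\in V(G)\setminus X$. -}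

module Defs where

open import Algebra.Properties.Semiring.Sum using (sum)
open import Data.Bool using (Bool; true; false; not; _∧_)
open import Data.Fin using (Fin; splitAt; _<?_; _≟_)
open import Data.Fin.Subset using (Subset; ∣_∣; _∈_; _∉_)
open import Data.Integer as ℤ using (ℤ; +_)
open import Data.Nat using (ℕ; zero; suc; _+_; _*_; _∸_; _≤_; _<_; _%_; NonZero; >-nonZero)
open import Data.Nat.Divisibility using (_∣_)
open import Data.Nat.Properties using (+-*-semiring; m*n≢0; m<n⇒0<n∸m)
open import Data.Product using (Σ-syntax; ∃-syntax; _×_)
open import Data.Rational as ℚ using (ℚ)
open import Data.Sum using (_⊎_; inj₁; inj₂)
open import Data.Vec using (tabulate)
open import Function.Bundles using (_↔_; Inverse)
open import Relation.Binary.Construct.Closure.ReflexiveTransitive using (Star)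
open import Relation.Binary.PropositionalEquality using (_≡_; refl; sym; cong)
open import Relation.Nullary.Decidable using (does; dec-true; dec-false; yes; no)

record Graph (n : ℕ) : Set where
  field
    adj        : Fin n → Fin n → Bool
    adj-sym    : ∀ u v → adj u v ≡ adj v u
    adj-irrefl : ∀ v → adj v v ≡ false

open Graph public

Adjacent : ∀ {n} → Graph n → Fin n → Fin n → Set
Adjacent G u v = adj G u v ≡ true

neighbours : ∀ {n} → Graph n → Fin n → Subset n
neighbours G v = tabulate (adj G v)

degree : ∀ {n} → Graph n → Fin n → ℕ
degree G v = ∣ neighbours G v ∣

-- Each edge {u , v} is counted once, at its smaller endpoint.
size : ∀ {n} → Graph n → ℕ
size G = sum +-*-semiring λ u → ∣ tabulate (λ v → does (u <? v) ∧ adj G u v) ∣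

Connected : ∀ {n} → Graph n → Set
Connected G = ∀ u v → Star (Adjacent G) u v

IsMinDegree : ∀ {n} → Graph n → ℕ → Set
IsMinDegree G δ = (∃[ v ] degree G v ≡ δ) × (∀ v → δ ≤ degree G v)

-- Isomorphism; the orders are separate indices because the order of an
-- explicitly constructed graph need not be definitionally n.
_≅_ : ∀ {m n} → Graph m → Graph n → Set
_≅_ {m} {n} G H =
  Σ[ φ ∈ Fin m ↔ Fin n ] (∀ u v → adj G u v ≡ adj H (Inverse.to φ u) (Inverse.to φ v))

K : (m : ℕ) → Graph m
K m .adj u v = not (does (u ≟ v))
K m .adj-sym u v with u ≟ v
... | yes u≡v = cong not (sym (dec-true (v ≟ u) (sym u≡v)))
... | no  u≢v = cong not (sym (dec-false (v ≟ u) (λ v≡u → u≢v (sym v≡u))))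
K m .adj-irrefl v = cong not (dec-true (v ≟ v) refl)

-- Disjoint union of G and H in which all (cross = true) or none
-- (cross = false) of the pairs with one vertex in each are edges.
module Combine (cross : Bool) {m n : ℕ} (G : Graph m) (H : Graph n) where

  adj⊎ : Fin m ⊎ Fin n → Fin m ⊎ Fin n → Bool
  adj⊎ (inj₁ u) (inj₁ v) = adj G u v
  adj⊎ (inj₁ _) (inj₂ _) = cross
  adj⊎ (inj₂ _) (inj₁ _) = cross
  adj⊎ (inj₂ u) (inj₂ v) = adj H u v

  adj⊎-sym : ∀ x y → adj⊎ x y ≡ adj⊎ y x
  adj⊎-sym (inj₁ u) (inj₁ v) = adj-sym G u v
  adj⊎-sym (inj₁ _) (inj₂ _) = refl
  adj⊎-sym (inj₂ _) (inj₁ _) = refl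
  adj⊎-sym (inj₂ u) (inj₂ v) = adj-sym H u v

  adj⊎-irrefl : ∀ x → adj⊎ x x ≡ false
  adj⊎-irrefl (inj₁ v) = adj-irrefl G v
  adj⊎-irrefl (inj₂ v) = adj-irrefl H v

  combine : Graph (m + n)
  combine .adj u v = adj⊎ (splitAt m u) (splitAt m v)
  combine .adj-sym u v = adj⊎-sym (splitAt m u) (splitAt m v)
  combine .adj-irrefl v = adj⊎-irrefl (splitAt m v)

infixr 6 _∪_
infixr 5 _∨_
infixr 7 _·_

_∪_ : ∀ {m n} → Graph m → Graph n → Graph (m + n)
G ∪ H = Combine.combine false G H

_∨_ : ∀ {m n} → Graph m → Graph n → Graph (m + n)
G ∨ H = Combine.combine true G H

_·_ : ∀ {n} (m : ℕ) → Graph n → Graph (m * n)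
zero  · G = K 0
suc m · G = G ∪ m · G

SpanningSubgraph : ∀ {n} → Graph n → Graph n → Set
SpanningSubgraph F G = ∀ u v → Adjacent F u v → Adjacent G u v

StrongParityProperty : ∀ {n} → ℕ → Graph n → Set
StrongParityProperty {n} k G =
  (X : Subset n) → 2 ∣ ∣ X ∣ →
  ∃[ F ] SpanningSubgraph F G
       × (∀ u → u ∈ X → degree F u % 2 ≡ 1)
       × (∀ v → v ∉ X → ∃[ j ] degree F v ≡ k + 2 * j)

-- Truncated subtraction agrees with integer subtraction here when k ≤ δ and
-- (δ - k + 1)δ + 1 ≤ n; the graph then has order n.
extremal : (n k δ : ℕ) →
  Graph (δ + ((n ∸ (δ ∸ k + 1) * δ ∸ 1) + ((δ ∸ k) * δ + 1) * 1))
extremal n k δ = K δ ∨ (K (n ∸ (δ ∸ k + 1) * δ ∸ 1) ∪ ((δ ∸ k) * δ + 1) · K 1)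

orderBound : (k δ : ℕ) → k < δ → ℚ
orderBound k δ k<δ =
  ((a ℤ.* a) ℚ./ (6 * (δ ∸ k)) ℚ.+ (+ (δ + k + 1)) ℚ./ 1) ℚ.⊔ (b ℚ./ 1)
  where
  instance
    δ∸k≢0 : NonZero (δ ∸ k)
    δ∸k≢0 = >-nonZero (m<n⇒0<n∸m k<δ)

    6[δ∸k]≢0 : NonZero (6 * (δ ∸ k))
    6[δ∸k]≢0 = m*n≢0 6 (δ ∸ k)

  d κ a b : ℤ
  d = + δ
  κ = + k
  a = d ℤ.* d ℤ.+ (+ 2 ℤ.- κ) ℤ.* d ℤ.- + 2 ℤ.* κ ℤ.- + 1
  b = d ℤ.* d ℤ.+ + 4 ℤ.* d ℤ.- κ ℤ.* κ ℤ.+ + 6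

{-# OPTIONS --safe #-}

-- Deleting H from G turns the required factor F into a spanning subgraph H
-- with d_H(v) ≤ b(v) and d_H(v) ≡ b(v) mod 2, where b(v) = d_G(v) - 1 on X and
-- b(v) = d_G(v) - k off X.  Blowing up each v into b(v) twins makes H a perfect
-- matching, so by Tutte's theorem (proved by Gallai's exchange argument) either
-- H exists or some vertex set T leaves b(T) + 2 classes with no edges between
-- them.  In the latter case classes with at most δ vertices send at least δ
-- edges to T and the others at least one.  Since d_G(T) ≤ b(T) + k|T|, there
-- are fewer than |T| of the former and hence many of the latter, so that at
-- least (δ - k)δ + 1 vertices lie outside a largest class and G has fewer edges
-- than the extremal graph (if all classes have at most δ vertices, G is sparse
-- outright).
module Submission where

open import Data.Bool using (Bool; true; false; not; _∧_; if_then_else_) renaming (_∨_ to _or_)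
import Data.Bool.Properties as Bool
open import Data.Empty using (⊥-elim)
open import Data.Fin using (Fin; zero; suc; _≟_; _<?_; _↑ˡ_; _↑ʳ_; splitAt)
import Data.Fin.Permutation as Perm
open import Data.Fin.Permutation.Components using (transpose)
import Data.Fin.Properties as Fin
open import Data.Fin.Properties using (any?; all?; splitAt-↑ˡ; splitAt-↑ʳ)
open import Data.Fin.Subset using (Subset; ∣_∣; _∈_; _∉_)
import Data.Integer as ℤ
open import Data.Integer using (ℤ)
import Data.Integer.Properties as ℤ
import Data.Integer.Tactic.RingSolver as ℤSolver
open import Data.Nat
  using (ℕ; zero; suc; _+_; _*_; _∸_; _≤_; _<_; _≥_; z≤n; s≤s; _≤?_; _%_; NonZero; >-nonZero)
open import Data.Nat.Divisibility using (_∣_; divides; ∣m+n∣m⇒∣n; m∣m*n; ∣m∣n⇒∣m+n)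
open import Data.Nat.DivMod using ([m+kn]%n≡m%n)
import Data.Nat.Properties as ℕ
open import Data.Nat.Properties hiding (_≟_; _<?_; _≤?_)
open import Data.Nat.Tactic.RingSolver using (solve-∀)
open import Data.Product using (∃; ∃-syntax; Σ-syntax; _×_; _,_; proj₁; proj₂)
open import Data.Rational as ℚ using ()
import Data.Rational.Properties as ℚ
open import Data.Rational.Unnormalised using (mkℚᵘ)
import Data.Rational.Unnormalised.Properties as ℚᵘ
open import Data.Sum using (_⊎_; inj₁; inj₂; [_,_]′)
open import Data.Vec using (tabulate; lookup)
open import Data.Vec.Functional using () renaming (_∷_ to _∷ᶠ_)
open import Data.Vec.Properties using (tabulate∘lookup; []=⇒lookup; lookup⇒[]=)
open import Function using (_∘_; id; const; mk⇔)
open import Relation.Binary using (tri<; tri≈; tri>)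
open import Relation.Binary.Construct.Closure.ReflexiveTransitive using (Star; ε; _◅_)
open import Relation.Binary.PropositionalEquality
  using (_≡_; _≢_; _≗_; refl; sym; trans; cong; cong₂; subst; subst₂; module ≡-Reasoning)
open import Relation.Nullary using (¬_; Dec; yes; no; does; contradiction)
open import Relation.Nullary.Decidable
  using (map′; dec-true; dec-false; ¬?; _×-dec_; _→-dec_; does-⇔)
open import Relation.Unary using (Decidable)
open import Algebra.Properties.Semiring.Sum +-*-semiring
  using (sum; sum-cong-≗; ∑-distrib-+; *-distribˡ-sum; *-distribʳ-sum; ∑-comm; sum-permute)
open import Defs

-- Sums and indicators

-- The degrees of F are restricted only from below and in parity, and passing to the complement
-- turns the lower bounds into upper bounds, which finitely many twins can express. The 2 in b(T) +
-- 2 is where the parity of b enters: with 1 in its place, T = ∅ together with all of G as a single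
-- class would satisfy the condition. No oddness of the classes is recorded; being nonempty and
-- without edges between them is enough for the edge count. Edges are counted twice, as degree sums,
-- so that no division occurs. With r = (δ - k)δ + 1 and N′ = n - r, the extremal graph is a clique
-- on N′ vertices plus r further vertices of degree δ, so twice its size is N′(N′ - 1) + 2rδ. This
-- is the origin of the inequalities of the form `e₂ + N′ < N′ * N′ + 2 * r * δ`.

⟦_⟧ : Bool → ℕ
⟦ true ⟧ = 1
⟦ false ⟧ = 0

⟦⟧≤1 : ∀ b → ⟦ b ⟧ ≤ 1
⟦⟧≤1 true = ≤-refl
⟦⟧≤1 false = z≤n

𝟙 : {P : Set} → Dec P → ℕ
𝟙 d = ⟦ does d ⟧

𝟙-yes : {P : Set} (d : Dec P) → P → 𝟙 d ≡ 1
𝟙-yes d p = cong ⟦_⟧ (dec-true d p)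

𝟙-no : {P : Set} (d : Dec P) → ¬ P → 𝟙 d ≡ 0
𝟙-no d ¬p = cong ⟦_⟧ (dec-false d ¬p)

𝟙-mono : {P Q : Set} (d : Dec P) (e : Dec Q) → (P → Q) → 𝟙 d ≤ 𝟙 e
𝟙-mono (yes p) e f = ≤-reflexive (sym (𝟙-yes e (f p)))
𝟙-mono (no _) e f = z≤n

𝟙-cong : {P Q : Set} (d : Dec P) (e : Dec Q) → (P → Q) → (Q → P) → 𝟙 d ≡ 𝟙 e
𝟙-cong d e f g = ≤-antisym (𝟙-mono d e f) (𝟙-mono e d g)

# : ∀ {n} → (Fin n → Bool) → ℕ
# p = sum (⟦_⟧ ∘ p)

∣tabulate∣ : ∀ {n} (p : Fin n → Bool) → ∣ tabulate p ∣ ≡ # p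
∣tabulate∣ {zero} p = refl
∣tabulate∣ {suc n} p with p zero
... | true = cong suc (∣tabulate∣ (p ∘ suc))
... | false = ∣tabulate∣ (p ∘ suc)

sum-mono-≤ : ∀ {n} {f g : Fin n → ℕ} → (∀ i → f i ≤ g i) → sum f ≤ sum g
sum-mono-≤ {zero} f≤g = z≤n
sum-mono-≤ {suc n} f≤g = +-mono-≤ (f≤g zero) (sum-mono-≤ (f≤g ∘ suc))

sum-mono-< : ∀ {n} {f g : Fin n → ℕ} → (∀ i → f i ≤ g i) → ∀ i → f i < g i → sum f < sum g
sum-mono-< f≤g zero lt = +-mono-<-≤ lt (sum-mono-≤ (f≤g ∘ suc))
sum-mono-< f≤g (suc i) lt = +-mono-≤-< (f≤g zero) (sum-mono-< (f≤g ∘ suc) i lt)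

sum-const : ∀ n c → sum {n} (λ _ → c) ≡ n * c
sum-const zero c = refl
sum-const (suc n) c = cong (c +_) (sum-const n c)

sum-zero : ∀ {n} {f : Fin n → ℕ} → (∀ i → f i ≡ 0) → sum f ≡ 0
sum-zero {n} f≡0 = trans (sum-cong-≗ f≡0) (trans (sum-const n 0) (*-zeroʳ n))

sum-pick : ∀ {n} (u : Fin n) (f : Fin n → ℕ) → sum (λ i → 𝟙 (i ≟ u) * f i) ≡ f u
sum-pick {suc n} zero f =
  trans (cong₂ _+_ (*-identityˡ (f zero)) (sum-zero {n} {λ _ → 0} (λ _ → refl))) (+-identityʳ _)
sum-pick (suc u) f = sum-pick u (f ∘ suc)

sum-𝟙≟ : ∀ {n} (u : Fin n) → sum (λ i → 𝟙 (i ≟ u)) ≡ 1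
sum-𝟙≟ u = trans (sum-cong-≗ (λ i → sym (*-identityʳ (𝟙 (i ≟ u))))) (sum-pick u (λ _ → 1))

term≤sum : ∀ {n} (f : Fin n → ℕ) i → f i ≤ sum f
term≤sum f zero = m≤m+n _ _
term≤sum f (suc i) = ≤-trans (term≤sum (f ∘ suc) i) (m≤n+m _ _)

sum-positive : ∀ {n} (f : Fin n → ℕ) → 1 ≤ sum f → ∃[ i ] 1 ≤ f i
sum-positive {suc n} f pos with f zero in eq
... | suc _ = zero , subst (1 ≤_) (sym eq) (s≤s z≤n)
... | zero with i , fi ← sum-positive (f ∘ suc) pos = suc i , fi

sum-++ : ∀ m {n} (f : Fin (m + n) → ℕ) →
         sum f ≡ sum (λ i → f (i ↑ˡ n)) + sum (λ j → f (m ↑ʳ j))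
sum-++ zero f = refl
sum-++ (suc m) f = trans (cong (f zero +_) (sum-++ m (f ∘ suc))) (sym (+-assoc (f zero) _ _))

∑-distrib-+₃ : ∀ {n} (f g h : Fin n → ℕ) →
               sum (λ i → f i + g i + h i) ≡ sum f + sum g + sum h
∑-distrib-+₃ f g h = trans (∑-distrib-+ (λ i → f i + g i) h) (cong (_+ sum h) (∑-distrib-+ f g))

-- Finite search

-- A function is recovered from its head and tail only pointwise, so the search is exhaustive for
-- predicates that respect pointwise equality; this takes the place of function extensionality.
search : ∀ {m n} (P : (Fin m → Fin n) → Set) → (∀ {f g} → f ≗ g → P f → P g) →
         Decidable P → Dec (∃ P)
search {zero} P resp P? = map′ (_ ,_) (λ (f , p) → resp (λ ()) p) (P? (λ ()))
search {suc m} P resp P? =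
  map′ (λ (x , g , p) → x ∷ᶠ g , p)
       (λ (f , p) → f zero , f ∘ suc , resp (λ { zero → refl ; (suc _) → refl }) p)
       (any? (λ x → search (λ g → P (x ∷ᶠ g)) (λ g≗h → resp (λ { zero → refl ; (suc i) → g≗h i }))
                           (λ g → P? (x ∷ᶠ g))))

least : (P : ℕ → Set) → Decidable P → ∀ n → P n → ∃[ m ] P m × (∀ l → P l → m ≤ l)
least P P? zero p = 0 , p , (λ _ _ → z≤n)
least P P? (suc n) p with P? 0
... | yes p₀ = 0 , p₀ , (λ _ _ → z≤n)
... | no ¬p₀ with m , pm , min ← least (P ∘ suc) (P? ∘ suc) n p =
  suc m , pm , λ { zero p₀ → contradiction p₀ ¬p₀ ; (suc l) pl → s≤s (min l pl) }

-- Involutions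

-- Moved points come in pairs `v`, `f v` of equal weight. Weight 1 gives the parity of the number of
-- unmatched vertices; the weight that marks pairs inside one fibre gives the parity of the loops in
-- a blow-up.
involution-parity : ∀ {n} (f : Fin n → Fin n) → (∀ v → f (f v) ≡ v) →
  (w : Fin n → ℕ) → (∀ v → w (f v) ≡ w v) →
  ∃[ e ] sum w ≡ sum (λ v → 𝟙 (f v ≟ v) * w v) + 2 * e
involution-parity f ff w wf = up , (begin
  sum w
    ≡⟨ sum-cong-≗ split ⟩
  sum (λ v → 𝟙 (f v ≟ v) * w v + 𝟙 (v <? f v) * w v + 𝟙 (f v <? v) * w v)
    ≡⟨ ∑-distrib-+₃ (λ v → 𝟙 (f v ≟ v) * w v) (λ v → 𝟙 (v <? f v) * w v) _ ⟩
  fixed + up + sum (λ v → 𝟙 (f v <? v) * w v)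
    ≡⟨ cong (fixed + up +_) flip ⟩
  fixed + up + up
    ≡⟨ +-assoc fixed up up ⟩
  fixed + (up + up)
    ≡⟨ cong (λ x → fixed + (up + x)) (+-identityʳ up) ⟨
  fixed + 2 * up ∎)
  where
  open ≡-Reasoning
  fixed = sum (λ v → 𝟙 (f v ≟ v) * w v)
  up = sum (λ v → 𝟙 (v <? f v) * w v)

  split : ∀ v → w v ≡ 𝟙 (f v ≟ v) * w v + 𝟙 (v <? f v) * w v + 𝟙 (f v <? v) * w v
  split v with Fin.<-cmp v (f v)
  ... | tri< a b c rewrite 𝟙-no (f v ≟ v) (b ∘ sym) | 𝟙-yes (v <? f v) a | 𝟙-no (f v <? v) c =
    sym (trans (+-identityʳ _) (+-identityʳ _))
  ... | tri≈ a b c rewrite 𝟙-yes (f v ≟ v) (sym b) | 𝟙-no (v <? f v) a | 𝟙-no (f v <? v) c =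
    sym (trans (+-identityʳ _) (trans (+-identityʳ _) (+-identityʳ _)))
  ... | tri> a b c rewrite 𝟙-no (f v ≟ v) (b ∘ sym) | 𝟙-no (v <? f v) a | 𝟙-yes (f v <? v) c =
    sym (+-identityʳ _)

  flip : sum (λ v → 𝟙 (f v <? v) * w v) ≡ up
  flip = trans (sum-permute _ (Perm.permutation f f ff ff))
               (sum-cong-≗ (λ v → cong₂ _*_ (cong (λ x → 𝟙 (x <? f v)) (ff v)) (wf v)))

-- Tutte's theorem

-- Each label class is a union of components of what remains after the removal. Only `used` labels
-- are counted and must be inhabited, which leaves room for a default label.
record Barrier {n} (G : Graph n) (b : Fin n → ℕ) : Set where
  field
    {labels}   : ℕ
    removed    : Fin n → Bool
    label      : Fin n → Fin labels
    used       : Fin labels → Bool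
    compatible : ∀ u v → Adjacent G u v → removed u ≡ false → removed v ≡ false →
                 label u ≡ label v
    inhabited  : ∀ j → used j ≡ true → ∃[ v ] (removed v ≡ false × label v ≡ j)
    many       : sum (λ v → ⟦ removed v ⟧ * b v) + 2 ≤ # used

transpose-iij : ∀ {n} (i j : Fin n) → transpose i j i ≡ j
transpose-iij i j rewrite dec-true (i ≟ i) refl = refl

transpose-ijj : ∀ {n} (i j : Fin n) → transpose i j j ≡ i
transpose-ijj i j with j ≟ i
... | yes j≡i = j≡i
... | no _ rewrite dec-true (j ≟ j) refl = refl

transpose-other : ∀ {n} (i j : Fin n) {k} → k ≢ i → k ≢ j → transpose i j k ≡ k
transpose-other i j {k} k≢i k≢j rewrite dec-false (k ≟ i) k≢i | dec-false (k ≟ j) k≢j = refl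

transpose-involutive : ∀ {n} (i j k : Fin n) → transpose i j (transpose i j k) ≡ k
transpose-involutive i j k with k ≟ i
... | yes refl = transpose-ijj i j
... | no k≢i with k ≟ j
...   | yes refl = transpose-iij i j
...   | no k≢j = transpose-other i j k≢i k≢j

≢true⇒≡false : ∀ {b} → b ≢ true → b ≡ false
≢true⇒≡false {true} b≢true = contradiction refl b≢true
≢true⇒≡false {false} _ = refl

module _ {N} (Γ : Graph N) where

  -- A matching is an involution; its fixed points are the unmatched vertices.
  record Matching (T : Fin N → Bool) (f : Fin N → Fin N) : Set where
    field
      invol : ∀ v → f (f v) ≡ v
      edge  : ∀ v → f v ≢ v → Adjacent Γ v (f v)
      free  : ∀ v → f v ≢ v → T v ≡ false

  open Matching

  -- The vertices of `T` are fixed by every `Matching T` and are included here. A deficiency of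
  -- `2 + # T` outside `T` therefore reads `2 + 2 * # T` below.
  unmatched : (Fin N → Fin N) → ℕ
  unmatched f = sum (λ v → 𝟙 (f v ≟ v))

  unmatched-cong : ∀ {f g} → f ≗ g → unmatched f ≡ unmatched g
  unmatched-cong {f} {g} f≗g = sum-cong-≗ (λ v → cong (λ x → 𝟙 (x ≟ v)) (f≗g v))

  matching-resp : ∀ {T f g} → f ≗ g → Matching T f → Matching T g
  matching-resp {f = f} {g} f≗g m .invol v =
    trans (sym (f≗g (g v))) (trans (cong f (sym (f≗g v))) (invol m v))
  matching-resp f≗g m .edge v gv≢v =
    subst (Adjacent Γ v) (f≗g v) (edge m v (gv≢v ∘ trans (sym (f≗g v))))
  matching-resp f≗g m .free v gv≢v = free m v (gv≢v ∘ trans (sym (f≗g v)))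

  matching? : ∀ T → Decidable (Matching T)
  matching? T f =
    map′ (λ (i , e , t) → record { invol = i ; edge = e ; free = t })
         (λ m → invol m , edge m , free m)
         (all? (λ v → f (f v) ≟ v) ×-dec
          all? (λ v → ¬? (f v ≟ v) →-dec adj Γ v (f v) Bool.≟ true) ×-dec
          all? (λ v → ¬? (f v ≟ v) →-dec T v Bool.≟ false))

  unmatched-parity : ∀ {T f} → Matching T f → ∃[ e ] N ≡ unmatched f + 2 * e
  unmatched-parity {f = f} m
    with e , eq ← involution-parity f (invol m) (λ _ → 1) (λ _ → refl) =
    e , trans (sym (trans (sum-const N 1) (*-identityʳ N)))
              (trans eq (cong (_+ 2 * e) (sum-cong-≗ (λ v → *-identityʳ (𝟙 (f v ≟ v))))))

  addEdge : ∀ {T f x y} → Matching T f → f x ≡ x → f y ≡ y → Adjacent Γ x y →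
            T x ≡ false → T y ≡ false → ∃[ g ] Matching T g × unmatched g < unmatched f
  addEdge {T} {f} {x} {y} m fx fy xy Tx Ty = g , gm , lt
    where
    x≢y : x ≢ y
    x≢y refl with () ← trans (sym xy) (adj-irrefl Γ x)

    g : Fin N → Fin N
    g v = transpose x y (f v)

    gx : g x ≡ y
    gx = trans (cong (transpose x y) fx) (transpose-iij x y)

    gy : g y ≡ x
    gy = trans (cong (transpose x y) fy) (transpose-ijj x y)

    go : ∀ {v} → v ≢ x → v ≢ y → g v ≡ f v
    go {v} v≢x v≢y = transpose-other x y
      (λ fv≡x → v≢x (trans (sym (invol m v)) (trans (cong f fv≡x) fx)))
      (λ fv≡y → v≢y (trans (sym (invol m v)) (trans (cong f fv≡y) fy)))

    gm : Matching T g
    gm .invol v with v ≟ x | v ≟ y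
    ... | yes refl | _ = trans (cong g gx) gy
    ... | no _ | yes refl = trans (cong g gy) gx
    ... | no v≢x | no v≢y = trans (cong g (go v≢x v≢y))
      (trans (cong (transpose x y) (invol m v)) (transpose-other x y v≢x v≢y))
    gm .edge v gv≢v with v ≟ x | v ≟ y
    ... | yes refl | _ = subst (Adjacent Γ x) (sym gx) xy
    ... | no _ | yes refl = subst (Adjacent Γ y) (sym gy) (trans (adj-sym Γ y x) xy)
    ... | no v≢x | no v≢y = subst (Adjacent Γ v) (sym (go v≢x v≢y))
      (edge m v (gv≢v ∘ trans (go v≢x v≢y)))
    gm .free v gv≢v with v ≟ x | v ≟ y
    ... | yes refl | _ = Tx
    ... | no _ | yes refl = Ty
    ... | no v≢x | no v≢y = free m v (gv≢v ∘ trans (go v≢x v≢y))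

    g-fix : ∀ v → g v ≡ v → f v ≡ v
    g-fix v gv with v ≟ x | v ≟ y
    ... | yes refl | _ = fx
    ... | no _ | yes refl = fy
    ... | no v≢x | no v≢y = trans (sym (go v≢x v≢y)) gv

    lt : unmatched g < unmatched f
    lt = sum-mono-< (λ v → 𝟙-mono (g v ≟ v) (f v ≟ v) (g-fix v)) x
      (subst (_≤ 𝟙 (f x ≟ x)) (cong suc (sym (𝟙-no (g x ≟ x) (λ gx≡x → x≢y (trans (sym gx≡x) gx)))))
        (≤-reflexive (sym (𝟙-yes (f x ≟ x) fx))))

  -- Gallai's lemma for maximum matchings avoiding `T`

  module Maximum (T : Fin N → Bool) (μ : ℕ)
                 (least-μ : ∀ f → Matching T f → μ ≤ unmatched f) where

    Max : (Fin N → Fin N) → Set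
    Max f = Matching T f × unmatched f ≡ μ

    -- The inessential vertices of the Gallai-Edmonds decomposition.
    Missed : Fin N → Set
    Missed v = ∃[ f ] Max f × f v ≡ v

    missed? : Decidable Missed
    missed? v = search _
      (λ f≗g ((m , eq) , fv) →
        (matching-resp f≗g m , trans (sym (unmatched-cong f≗g)) eq) , trans (sym (f≗g v)) fv)
      (λ f → (matching? T f ×-dec (unmatched f ℕ.≟ μ)) ×-dec (f v ≟ v))

    infix 4 _≈_
    -- Adjacent vertices outside `T` are related, since otherwise their edge would augment some
    -- maximum matching. Once transitivity is available, the relation can stand in for
    -- connectedness.
    _≈_ : Fin N → Fin N → Set
    u ≈ v = ∀ f → Max f → f u ≡ u → f v ≡ v → u ≡ v

    ≈-sym : ∀ {u v} → u ≈ v → v ≈ u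
    ≈-sym u≈v f F fv fu = sym (u≈v f F fu fv)

    no-augmenting-edge : ∀ {f x y} → Max f → f x ≡ x → f y ≡ y → Adjacent Γ x y →
                         T x ≡ false → ¬ (T y ≡ false)
    no-augmenting-edge (m , eq) fx fy xy Tx Ty with g , gm , lt ← addEdge m fx fy xy Tx Ty =
      contradiction (≤-trans lt (≤-reflexive eq)) (≤⇒≯ (least-μ g gm))

    adjacent⇒≈ : ∀ {u v} → Adjacent Γ u v → T u ≡ false → T v ≡ false → u ≈ v
    adjacent⇒≈ uv Tu Tv f F fu fv = ⊥-elim (no-augmenting-edge F fu fv uv Tu Tv)

    ≈? : ∀ u v → Dec (u ≈ v)
    ≈? u v = map′ (λ ¬ex f F fu fv → dne (λ u≢v → ¬ex (f , F , fu , fv , u≢v)))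
                  (λ u≈v (f , F , fu , fv , u≢v) → u≢v (u≈v f F fu fv))
                  (¬? bad?)
      where
      dne : ¬ ¬ (u ≡ v) → u ≡ v
      dne ¬¬p with u ≟ v
      ... | yes p = p
      ... | no ¬p = contradiction ¬p ¬¬p
      bad? : Dec (∃[ f ] Max f × f u ≡ u × f v ≡ v × u ≢ v)
      bad? = search _
        (λ f≗g ((m , eq) , fu , fv , u≢v) →
          (matching-resp f≗g m , trans (sym (unmatched-cong f≗g)) eq) ,
          trans (sym (f≗g u)) fu , trans (sym (f≗g v)) fv , u≢v)
        (λ f → (matching? T f ×-dec (unmatched f ℕ.≟ μ)) ×-dec
               (f u ≟ u) ×-dec (f v ≟ v) ×-dec ¬? (u ≟ v))

    agreement : (f g : Fin N → Fin N) → ℕ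
    agreement f g = sum (λ v → 𝟙 (f v ≟ g v))

    -- Gallai's exchange: if M leaves u and v unmatched while g leaves w but
    -- neither u nor v unmatched, some x ≠ w is matched by M only; replacing
    -- the g-edge at y = M x by xy brings g closer to M.
    exchange : ∀ {M g u v w} → Max M → M u ≡ u → M v ≡ v → u ≢ v →
               Max g → g w ≡ w → g u ≢ u → g v ≢ v →
               ∃[ h ] Max h × h w ≡ w × agreement M g < agreement M h
    exchange {M} {g} {u} {v} {w} (Mm , Meq) Mu Mv u≢v (gm , geq) gw gu gv
      with any? (λ x → (g x ≟ x) ×-dec ¬? (x ≟ w) ×-dec ¬? (M x ≟ x))
    ... | no none = contradiction too-many (<⇒≱ (≤-reflexive (+-comm 1 (unmatched M + 1))))
      where
      -- Without such an `x`, every vertex other than `w` that `g` leaves unmatched is also left by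
      -- `M`, and `M` leaves `u` and `v` besides; so `g` would leave fewer vertices than `M`.
      pointwise : ∀ x → 𝟙 (g x ≟ x) + 𝟙 (x ≟ u) + 𝟙 (x ≟ v) ≤ 𝟙 (M x ≟ x) + 𝟙 (x ≟ w)
      pointwise x with x ≟ u | x ≟ v
      ... | yes refl | yes refl = contradiction refl u≢v
      ... | yes refl | no _ rewrite 𝟙-no (g u ≟ u) gu | 𝟙-yes (M u ≟ u) Mu = s≤s z≤n
      ... | no _ | yes refl rewrite 𝟙-no (g v ≟ v) gv | 𝟙-yes (M v ≟ v) Mv = s≤s z≤n
      ... | no _ | no _ with g x ≟ x
      ...   | no _ = z≤n
      ...   | yes gx with x ≟ w
      ...     | yes _ = m≤n+m 1 (𝟙 (M x ≟ x))
      ...     | no x≢w with M x ≟ x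
      ...       | yes _ = s≤s z≤n
      ...       | no Mx = contradiction (x , gx , x≢w , Mx) none

      too-many : unmatched M + 1 + 1 ≤ unmatched M + 1
      too-many = begin
        unmatched M + 1 + 1
          ≡⟨ cong₂ _+_ (cong₂ _+_ (trans Meq (sym geq)) (sym (sum-𝟙≟ u))) (sym (sum-𝟙≟ v)) ⟩
        unmatched g + sum (λ x → 𝟙 (x ≟ u)) + sum (λ x → 𝟙 (x ≟ v))
          ≡⟨ ∑-distrib-+₃ (λ x → 𝟙 (g x ≟ x)) (λ x → 𝟙 (x ≟ u)) (λ x → 𝟙 (x ≟ v)) ⟨
        sum (λ x → 𝟙 (g x ≟ x) + 𝟙 (x ≟ u) + 𝟙 (x ≟ v))
          ≤⟨ sum-mono-≤ pointwise ⟩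
        sum (λ x → 𝟙 (M x ≟ x) + 𝟙 (x ≟ w))
          ≡⟨ ∑-distrib-+ (λ x → 𝟙 (M x ≟ x)) (λ x → 𝟙 (x ≟ w)) ⟩
        unmatched M + sum (λ x → 𝟙 (x ≟ w))
          ≡⟨ cong (unmatched M +_) (sum-𝟙≟ w) ⟩
        unmatched M + 1 ∎
        where open ≤-Reasoning
    ... | yes (x , gx , x≢w , Mx) with g (M x) ≟ M x
    ...   | yes gy = ⊥-elim (no-augmenting-edge (gm , geq) gx gy (edge Mm x Mx)
              (free Mm x Mx) (free Mm (M x) (λ eq → Mx (sym (trans (sym (invol Mm x)) eq)))))
    ...   | no gy = h , (hm , trans hfix geq) , hw , closer
      where
      y z : Fin N
      y = M x
      z = g y
      τ : Fin N → Fin N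
      τ = transpose x z

      gz : g z ≡ y
      gz = invol gm y

      x≢z : x ≢ z
      x≢z x≡z = Mx (trans (sym gz) (trans (cong g (sym x≡z)) gx))

      data Position (k : Fin N) : Set where
        at-x : k ≡ x → Position k
        at-y : k ≡ y → Position k
        at-z : k ≡ z → Position k
        elsewhere : k ≢ x → k ≢ y → k ≢ z → Position k

      position : ∀ k → Position k
      position k with k ≟ x | k ≟ y | k ≟ z
      ... | yes a | _ | _ = at-x a
      ... | no _ | yes b | _ = at-y b
      ... | no _ | no _ | yes c = at-z c
      ... | no a | no b | no c = elsewhere a b c

      -- Conjugation by the transposition of `x` and `z` pairs `x` with `y` and leaves `z` unmatched
      -- in place of `x`. As a conjugate of `g` it is an involution with equally many fixed points.
      h : Fin N → Fin N
      h k = τ (g (τ k))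

      hx : h x ≡ y
      hx = trans (cong (τ ∘ g) (transpose-iij x z))
          (trans (cong τ gz) (transpose-other x z Mx (gy ∘ sym)))
      hy : h y ≡ x
      hy = trans (cong (τ ∘ g) (transpose-other x z Mx (gy ∘ sym))) (transpose-ijj x z)
      hz : h z ≡ z
      hz = trans (cong (τ ∘ g) (transpose-ijj x z)) (trans (cong τ gx) (transpose-iij x z))
      ho : ∀ {k} → k ≢ x → k ≢ y → k ≢ z → h k ≡ g k
      ho {k} k≢x k≢y k≢z = trans (cong (τ ∘ g) (transpose-other x z k≢x k≢z))
        (transpose-other x z
          (λ gk → k≢x (trans (sym (invol gm k)) (trans (cong g gk) gx)))
          (λ gk → k≢y (trans (sym (invol gm k)) (trans (cong g gk) gz))))

      hm : Matching T h
      hm .invol k = trans (cong (τ ∘ g) (transpose-involutive x z (g (τ k))))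
                   (trans (cong τ (invol gm (τ k))) (transpose-involutive x z k))
      hm .edge k hk with position k
      ... | at-x refl = subst (Adjacent Γ x) (sym hx) (edge Mm x Mx)
      ... | at-y refl =
        subst (Adjacent Γ y) (sym hy) (trans (adj-sym Γ y x) (edge Mm x Mx))
      ... | at-z refl = contradiction hz hk
      ... | elsewhere a b c = subst (Adjacent Γ k) (sym (ho a b c))
        (edge gm k (hk ∘ trans (ho a b c)))
      hm .free k hk with position k
      ... | at-x refl = free Mm x Mx
      ... | at-y refl = free gm y gy
      ... | at-z refl = contradiction hz hk
      ... | elsewhere a b c = free gm k (hk ∘ trans (ho a b c))

      hfix : unmatched h ≡ unmatched g
      hfix = trans (sum-cong-≗ (λ k → 𝟙-cong (h k ≟ k) (g (τ k) ≟ τ k)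
                      (λ e → trans (sym (transpose-involutive x z (g (τ k)))) (cong τ e))
                      (λ e → trans (cong τ e) (transpose-involutive x z k))))
                   (sym (sum-permute (λ k → 𝟙 (g k ≟ k))
                     (Perm.permutation τ τ (transpose-involutive x z) (transpose-involutive x z))))

      hw : h w ≡ w
      hw = trans (ho (x≢w ∘ sym) (λ { refl → gy gw })
                     (λ { refl → gy (trans (sym gw) gz) })) gw

      agree : ∀ k → M k ≡ g k → M k ≡ h k
      agree k e with position k
      ... | at-x refl = sym hx
      ... | at-y refl = contradiction (trans (sym (invol Mm x)) e) x≢z
      ... | at-z refl =
        contradiction (trans (sym (invol Mm x)) (trans (cong M (sym (trans e gz)))
                      (invol Mm z))) x≢z
      ... | elsewhere a b c = trans e (sym (ho a b c))

      closer : agreement M g < agreement M h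
      closer = sum-mono-< (λ k → 𝟙-mono (M k ≟ g k) (M k ≟ h k) (agree k)) x
        (subst (_≤ 𝟙 (M x ≟ h x))
               (cong suc (sym (𝟙-no (M x ≟ g x) (λ e → Mx (trans e gx)))))
               (≤-reflexive (sym (𝟙-yes (M x ≟ h x) (sym hx)))))

    agreement≤N : ∀ f g → agreement f g ≤ N
    agreement≤N f g = ≤-trans (sum-mono-≤ (λ v → ⟦⟧≤1 (does (f v ≟ g v))))
      (≤-reflexive (trans (sum-const N 1) (*-identityʳ N)))

    -- Suppose `M` left distinct `u` and `v` unmatched. A maximum matching that misses `w` must
    -- match both, by the two hypotheses, and `exchange` yields another one that misses `w` and
    -- agrees with `M` in more places. This can be repeated forever, although agreement is at most
    -- `N`.
    ≈-trans : ∀ {u v w} → Missed w → u ≈ w → w ≈ v → u ≈ v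
    ≈-trans {u} {v} {w} (g₀ , G₀ , g₀w) u≈w w≈v M F Mu Mv with u ≟ v | w ≟ u | w ≟ v
    ... | yes u≡v | _ | _ = u≡v
    ... | no _ | yes refl | _ = w≈v M F Mu Mv
    ... | no _ | no _ | yes refl = u≈w M F Mu Mv
    ... | no u≢v | no w≢u | no w≢v =
      approach N g₀ G₀ g₀w (m≤m+n N (agreement M g₀))
      where
      approach : ∀ s g → Max g → g w ≡ w → N ≤ s + agreement M g → u ≡ v
      approach s g G gw close
        with h , H , hw , lt ← exchange F Mu Mv u≢v G gw
               (λ gu → w≢u (sym (u≈w g G gu gw))) (λ gv → w≢v (w≈v g G gw gv))
        with s
      ... | zero = contradiction (≤-trans lt (agreement≤N M h)) (≤⇒≯ close)
      ... | suc s′ = approach s′ h H hw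
        (≤-trans close (≤-trans (≤-reflexive (sym (+-suc s′ _))) (+-monoʳ-≤ s′ lt)))

    module _ {M} (MaxM : Max M) (large : 2 + 2 * # T ≤ μ)
             (inessential : ∀ v → T v ≡ false → Missed v) where

      rep : Fin N → Bool
      rep v = does (M v ≟ v) ∧ not (T v)

      rep-fixed : ∀ v → rep v ≡ true → M v ≡ v
      rep-fixed v r with M v ≟ v
      ... | yes Mv = Mv

      rep-free : ∀ v → rep v ≡ true → T v ≡ false
      rep-free v r with M v ≟ v | T v
      ... | yes _ | false = refl

      Represents : Fin N → Fin N → Set
      Represents v x = rep x ≡ true × x ≈ v

      represented? : ∀ v → Dec (∃ (Represents v))
      represented? v = any? (λ x → (rep x Bool.≟ true) ×-dec ≈? x v)

      -- Label `zero` gathers all vertices related to no representative; several classes may merge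
      -- there, which is harmless as it is never `used`.
      label : Fin N → Fin (suc N)
      label v with represented? v
      ... | yes (x , _) = suc x
      ... | no _ = zero

      label-represented : ∀ {v x} → T v ≡ false → Represents v x → label v ≡ suc x
      label-represented {v} {x} Tv (rx , x≈v) with represented? v
      ... | yes (y , ry , y≈v) = cong suc
        (≈-trans (inessential v Tv) y≈v (≈-sym x≈v) M MaxM (rep-fixed y ry) (rep-fixed x rx))
      ... | no none = contradiction (x , rx , x≈v) none

      compatible : ∀ u v → Adjacent Γ u v → T u ≡ false → T v ≡ false → label u ≡ label v
      compatible u v uv Tu Tv with represented? u
      ... | yes (x , rx , x≈u) = sym (label-represented Tv
        (rx , ≈-trans (inessential u Tu) x≈u (adjacent⇒≈ uv Tu Tv)))
      ... | no none with represented? v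
      ...   | no _ = refl
      ...   | yes (x , rx , x≈v) = contradiction
        (x , rx , ≈-trans (inessential v Tv) x≈v (≈-sym (adjacent⇒≈ uv Tu Tv))) none

      used : Fin (suc N) → Bool
      used zero = false
      used (suc x) = rep x

      -- Of the at least `2 + 2 * # T` vertices unmatched by `M`, at most `# T` lie in `T`; the
      -- others are pairwise unrelated because `M` itself misses them all.
      many-reps : sum (λ v → ⟦ T v ⟧ * 1) + 2 ≤ # rep
      many-reps = +-cancelʳ-≤ (# T) _ _ (begin
        sum (λ v → ⟦ T v ⟧ * 1) + 2 + # T
          ≡⟨ cong (λ t → t + 2 + # T) (sum-cong-≗ (λ v → *-identityʳ ⟦ T v ⟧)) ⟩
        # T + 2 + # T
          ≡⟨ rearr (# T) ⟩
        2 + 2 * # T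
          ≤⟨ large ⟩
        μ
          ≡⟨ proj₂ MaxM ⟨
        unmatched M
          ≤⟨ sum-mono-≤ pointwise ⟩
        sum (λ v → ⟦ rep v ⟧ + ⟦ T v ⟧)
          ≡⟨ ∑-distrib-+ (⟦_⟧ ∘ rep) (⟦_⟧ ∘ T) ⟩
        # rep + # T ∎)
        where
        open ≤-Reasoning
        rearr : ∀ t → t + 2 + t ≡ 2 + 2 * t
        rearr = solve-∀
        pointwise : ∀ v → 𝟙 (M v ≟ v) ≤ ⟦ rep v ⟧ + ⟦ T v ⟧
        pointwise v with M v ≟ v | T v
        ... | no _ | _ = z≤n
        ... | yes _ | true = s≤s z≤n
        ... | yes _ | false = s≤s z≤n

      barrier : Barrier Γ (λ _ → 1)
      barrier = record
        { removed = T
        ; label = label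
        ; used = used
        ; compatible = compatible
        ; inhabited = λ { (suc x) rx → x , rep-free x rx ,
            label-represented (rep-free x rx) (rx , λ _ _ _ _ → refl) }
        ; many = many-reps }

  -- Growing a deficient set

  identity-matching : ∀ T → Matching T id
  identity-matching T = record
    { invol = λ _ → refl ; edge = λ v v≢v → contradiction refl v≢v
    ; free = λ v v≢v → contradiction refl v≢v }

  maximum : ∀ T → ∃[ f ] Matching T f × (∀ g → Matching T g → unmatched f ≤ unmatched g)
  maximum T with _ , (f , m , eq) , min ← least
      (λ μ → ∃[ f ] Matching T f × unmatched f ≡ μ)
      (λ μ → search _ (λ f≗g (m , eq) → matching-resp f≗g m , trans (sym (unmatched-cong f≗g)) eq)
                      (λ f → matching? T f ×-dec (unmatched f ℕ.≟ μ)))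
      (unmatched id) (id , identity-matching T , refl)
    = f , m , λ g gm → ≤-trans (≤-reflexive eq) (min _ (g , gm , refl))

  insert : Fin N → (Fin N → Bool) → Fin N → Bool
  insert x T v = does (v ≟ x) or T v

  #-insert : ∀ {x T} → T x ≡ false → # (insert x T) ≡ suc (# T)
  #-insert {x} {T} Tx = trans (sum-cong-≗ split)
    (trans (∑-distrib-+ (λ v → 𝟙 (v ≟ x)) (⟦_⟧ ∘ T)) (cong (_+ # T) (sum-𝟙≟ x)))
    where
    split : ∀ v → ⟦ insert x T v ⟧ ≡ 𝟙 (v ≟ x) + ⟦ T v ⟧
    split v with v ≟ x
    ... | yes refl = cong (λ b → suc ⟦ b ⟧) (sym Tx)
    ... | no _ = refl

  matching-insert : ∀ {x T f} → Matching (insert x T) f → Matching T f × f x ≡ x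
  matching-insert {x} {T} {f} m =
    record { invol = invol m ; edge = edge m ; free = free′ } , fixed
    where
    free′ : ∀ v → f v ≢ v → T v ≡ false
    free′ v fv with T v | free m v fv
    ... | false | _ = refl
    ... | true | eq with () ← trans (sym (Bool.∨-zeroʳ (does (v ≟ x)))) eq
    fixed : f x ≡ x
    fixed with f x ≟ x
    ... | yes fx = fx
    ... | no fx with () ← trans (sym (cong (_or T x) (dec-true (x ≟ x) refl))) (free m x fx)

  parity-gap : ∀ {T T′ f g} → Matching T f → Matching T′ g → unmatched f < unmatched g →
               2 + unmatched f ≤ unmatched g
  parity-gap {f = f} {g} mf mg lt
    with e , eq ← unmatched-parity mf | e′ , eq′ ← unmatched-parity mg
    with suc (unmatched f) ℕ.≟ unmatched g
  ... | no gap = ≤∧≢⇒< lt gap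
  ... | yes adjacent = contradiction
    (∣m+n∣m⇒∣n {2} {2 * e′} {1} (divides e odd) (m∣m*n e′)) λ { (divides zero ()) ; (divides (suc _) ()) }
    where
    odd : 2 * e′ + 1 ≡ e * 2
    odd = +-cancelˡ-≡ (unmatched f) _ _ (begin
      unmatched f + (2 * e′ + 1) ≡⟨ rearr (unmatched f) (2 * e′) ⟩
      suc (unmatched f) + 2 * e′ ≡⟨ cong (_+ 2 * e′) adjacent ⟩
      unmatched g + 2 * e′ ≡⟨ eq′ ⟨
      N ≡⟨ eq ⟩
      unmatched f + 2 * e ≡⟨ cong (unmatched f +_) (*-comm 2 e) ⟩
      unmatched f + e * 2 ∎)
      where
      open ≡-Reasoning
      rearr : ∀ a b → a + (b + 1) ≡ suc a + b
      rearr = solve-∀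

  -- If some `x` outside `T` is covered by every maximum matching, forbidding `x` raises the number
  -- of unmatched vertices, by parity at least by two, so the deficiency survives adding `x` to `T`.
  -- Once no such `x` remains, all vertices outside `T` are inessential and Gallai's lemma supplies
  -- the classes. The fuel `s` bounds the number of vertices still outside `T`.
  barrier-from : ∀ s T → N ≤ s + # T → (∀ f → Matching T f → 2 + 2 * # T ≤ unmatched f) →
                 Barrier Γ (λ _ → 1)
  barrier-from s T bound deficient with f , m , min ← maximum T
    with any? (λ v → (T v Bool.≟ false) ×-dec ¬? (Maximum.missed? T (unmatched f) min v))
  ... | no none = Maximum.barrier T (unmatched f) min (m , refl) (deficient f m) inessential
    where
    inessential : ∀ v → T v ≡ false → Maximum.Missed T (unmatched f) min v
    inessential v Tv with Maximum.missed? T (unmatched f) min v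
    ... | yes ms = ms
    ... | no ¬ms = contradiction (v , Tv , ¬ms) none
  ... | yes (x , Tx , essential) with s
  ...   | zero = contradiction (sum-mono-< {f = ⟦_⟧ ∘ T} {g = λ _ → 1} (λ v → ⟦⟧≤1 (T v)) x
                   (≤-reflexive (cong (λ b → suc ⟦ b ⟧) Tx)))
                 (≤⇒≯ (≤-trans (≤-reflexive (trans (sum-const N 1) (*-identityʳ N))) bound))
  ...   | suc s′ = barrier-from s′ (insert x T)
      (≤-trans bound (≤-reflexive (trans (sym (+-suc s′ _)) (cong (s′ +_) (sym (#-insert {x} {T} Tx))))))
      deficient′
    where
    deficient′ : ∀ g → Matching (insert x T) g → 2 + 2 * # (insert x T) ≤ unmatched g
    deficient′ g gm with gT , gx ← matching-insert {x} {T} gm = begin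
      2 + 2 * # (insert x T) ≡⟨ cong (λ t → 2 + 2 * t) (#-insert {x} {T} Tx) ⟩
      2 + 2 * suc (# T) ≡⟨ cong (2 +_) (*-suc 2 (# T)) ⟩
      2 + (2 + 2 * # T) ≤⟨ +-monoʳ-≤ 2 (deficient f m) ⟩
      2 + unmatched f ≤⟨ parity-gap m gm (≤∧≢⇒< (min g gT) (λ eq → essential (g , (gT , sym eq) , gx))) ⟩
      unmatched g ∎
      where open ≤-Reasoning

  tutte : 2 ∣ N → (∃[ f ] Matching (λ _ → false) f × (∀ v → f v ≢ v)) ⊎ Barrier Γ (λ _ → 1)
  tutte (divides q N≡q*2) with maximum (λ _ → false)
  ... | f , m , min with unmatched f in eq
  ...   | zero = inj₁ (f , m , perfect)
    where
    perfect : ∀ v → f v ≢ v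
    perfect v fv with () ← ≤-trans (≤-reflexive (sym (𝟙-yes (f v ≟ v) fv)))
      (≤-trans (term≤sum (λ u → 𝟙 (f u ≟ u)) v) (≤-reflexive eq))
  ...   | suc zero = contradiction
    (∣m+n∣m⇒∣n {2} {2 * proj₁ par} {1}
      (divides q (trans (+-comm (2 * proj₁ par) 1) (trans (cong (_+ 2 * proj₁ par) (sym eq)) (trans (sym (proj₂ par)) N≡q*2))))
      (m∣m*n (proj₁ par))) λ { (divides zero ()) ; (divides (suc _) ()) }
    where par = unmatched-parity m
  ...   | suc (suc d) = inj₂ (barrier-from N (λ _ → false) (m≤m+n N _)
    (λ g gm → ≤-trans (≤-reflexive (cong (λ t → 2 + 2 * t) (sum-zero {N} (λ _ → refl))))
                      (≤-trans (s≤s (s≤s z≤n)) (min g gm))))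

-- Degree-bounded joins by blowing up vertices

does-≟-sym : ∀ {n} (u v : Fin n) → does (u ≟ v) ≡ does (v ≟ u)
does-≟-sym u v = does-⇔ (mk⇔ sym sym) (u ≟ v) (v ≟ u)

sum-pickʳ : ∀ {n} (u : Fin n) (f : Fin n → ℕ) → sum (λ i → 𝟙 (u ≟ i) * f i) ≡ f u
sum-pickʳ u f = trans (sum-cong-≗ (λ i → cong (λ x → ⟦ x ⟧ * f i) (does-≟-sym u i))) (sum-pick u f)

sum-𝟙≟ʳ : ∀ {n} (u : Fin n) → sum (λ i → 𝟙 (u ≟ i)) ≡ 1
sum-𝟙≟ʳ u = trans (sum-cong-≗ (λ i → cong ⟦_⟧ (does-≟-sym u i))) (sum-𝟙≟ u)

fibration : ∀ {n} (b : Fin n → ℕ) →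
            ∃[ N ] Σ[ π ∈ (Fin N → Fin n) ] (∀ v → sum (λ i → 𝟙 (π i ≟ v)) ≡ b v)
fibration {zero} b = 0 , (λ ()) , λ ()
fibration {suc n} b with N , π , fibre ← fibration (b ∘ suc) =
  b zero + N , ρ , λ { zero → fibre₀ ; (suc v) → fibreₛ v }
  where
  ρ : Fin (b zero + N) → Fin (suc n)
  ρ i = [ const zero , suc ∘ π ]′ (splitAt (b zero) i)

  split : ∀ v → sum (λ i → 𝟙 (ρ i ≟ v)) ≡
          sum {b zero} (λ _ → 𝟙 (zero ≟ v)) + sum (λ j → 𝟙 (suc (π j) ≟ v))
  split v = trans (sum-++ (b zero) (λ i → 𝟙 (ρ i ≟ v))) (cong₂ _+_
    (sum-cong-≗ (λ i → cong (λ s → 𝟙 ([ const zero , suc ∘ π ]′ s ≟ v)) (splitAt-↑ˡ (b zero) i N)))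
    (sum-cong-≗ (λ j → cong (λ s → 𝟙 ([ const zero , suc ∘ π ]′ s ≟ v)) (splitAt-↑ʳ (b zero) N j))))

  fibre₀ : sum (λ i → 𝟙 (ρ i ≟ zero)) ≡ b zero
  fibre₀ = trans (split zero) (trans
    (cong₂ _+_ (trans (sum-const (b zero) 1) (*-identityʳ _)) (sum-zero {N} (λ _ → refl)))
    (+-identityʳ _))

  fibreₛ : ∀ v → sum (λ i → 𝟙 (ρ i ≟ suc v)) ≡ b (suc v)
  fibreₛ v = trans (split (suc v)) (cong₂ _+_ (sum-zero {b zero} (λ _ → refl)) (fibre v))

odd : ℕ → Bool
odd zero = false
odd (suc n) = not (odd n)

odd-halving : ∀ n → ∃[ h ] n ≡ ⟦ odd n ⟧ + 2 * h
odd-halving zero = 0 , refl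
odd-halving (suc n) with odd n | odd-halving n
... | true | h , eq = suc h , trans (cong suc eq) (sym (*-suc 2 h))
... | false | h , eq = h , cong suc eq

module Blowup {n N} (G : Graph n) (π : Fin N → Fin n) where

  -- Fibres are cliques for two reasons: an edge inside a fibre uses up two units of `b v`, which
  -- lets the degree drop below `b v` without changing parity; and the surviving copies of a vertex
  -- are forced into one class, so that a barrier can be projected.
  blowup : Graph N
  blowup .adj i j = not (does (i ≟ j)) ∧ (does (π i ≟ π j) or adj G (π i) (π j))
  blowup .adj-sym i j = cong₂ _∧_ (cong not (does-≟-sym i j))
    (cong₂ _or_ (does-≟-sym (π i) (π j)) (adj-sym G (π i) (π j)))
  blowup .adj-irrefl i rewrite dec-true (i ≟ i) refl = refl

  blowup-edge : ∀ {i j} → i ≢ j → π i ≡ π j ⊎ Adjacent G (π i) (π j) → Adjacent blowup i j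
  blowup-edge {i} {j} i≢j e rewrite dec-false (i ≟ j) i≢j with π i ≟ π j | e
  ... | yes _ | _ = refl
  ... | no _ | inj₂ a = a
  ... | no ¬p | inj₁ p = contradiction p ¬p

  blowup-edge⁻¹ : ∀ {i j} → Adjacent blowup i j → π i ≡ π j ⊎ Adjacent G (π i) (π j)
  blowup-edge⁻¹ {i} {j} e with i ≟ j | π i ≟ π j
  ... | no _ | yes p = inj₁ p
  ... | no _ | no _ = inj₂ e

  module _ {T f} (m : Matching blowup T f) (perfect : ∀ i → f i ≢ i) where
    open Matching m

    -- Ends of matching edges are counted, not edges, so an edge inside the fibre of `u` contributes
    -- 2 to `links u u`.
    links : Fin n → Fin n → ℕ
    links u v = sum (λ i → 𝟙 (π i ≟ u) * 𝟙 (π (f i) ≟ v))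

    links-sym : ∀ u v → links u v ≡ links v u
    links-sym u v = trans (sum-permute _ (Perm.permutation f f invol invol)) (sum-cong-≗ λ i →
      trans (cong (λ x → 𝟙 (π (f i) ≟ u) * 𝟙 (π x ≟ v)) (invol i))
            (*-comm (𝟙 (π (f i) ≟ u)) (𝟙 (π i ≟ v))))

    sum-links : ∀ u → sum (links u) ≡ sum (λ i → 𝟙 (π i ≟ u))
    sum-links u = trans (∑-comm (λ v i → 𝟙 (π i ≟ u) * 𝟙 (π (f i) ≟ v))) (sum-cong-≗ λ i →
      trans (sym (*-distribˡ-sum (𝟙 (π i ≟ u)) (λ v → 𝟙 (π (f i) ≟ v))))
            (trans (cong (𝟙 (π i ≟ u) *_) (sum-𝟙≟ʳ (π (f i)))) (*-identityʳ _)))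

    -- Matching edges inside a fibre use its points in pairs, and parallel
    -- ones cancel in pairs, so degrees keep the parity of the fibre sizes.
    join : Graph n
    join .adj u v = not (does (u ≟ v)) ∧ odd (links u v)
    join .adj-sym u v = cong₂ _∧_ (cong not (does-≟-sym u v)) (cong odd (links-sym u v))
    join .adj-irrefl u rewrite dec-true (u ≟ u) refl = refl

    links-parity : ∀ u v → ∃[ h ] links u v ≡ ⟦ adj join u v ⟧ + 2 * h
    links-parity u v with u ≟ v
    ... | no _ = odd-halving (links u v)
    -- On the diagonal `join` has no edge, so `links u u` must be even: the perfect matching
    -- permutes the counted points without fixed points.
    ... | yes refl with h , eq ← involution-parity f invol
                          (λ i → 𝟙 (π i ≟ u) * 𝟙 (π (f i) ≟ u))
                          (λ i → trans (cong (λ x → 𝟙 (π (f i) ≟ u) * 𝟙 (π x ≟ u)) (invol i))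
                                       (*-comm (𝟙 (π (f i) ≟ u)) _)) =
      h , trans eq (cong (_+ 2 * h) (sum-zero (λ i →
            cong (_* (𝟙 (π i ≟ u) * 𝟙 (π (f i) ≟ u))) (𝟙-no (f i ≟ i) (perfect i)))))

    join-degree : ∀ u → ∃[ j ] sum (λ i → 𝟙 (π i ≟ u)) ≡ degree join u + 2 * j
    join-degree u = sum h , (begin
      sum (λ i → 𝟙 (π i ≟ u))                  ≡⟨ sum-links u ⟨
      sum (links u)                             ≡⟨ sum-cong-≗ (proj₂ ∘ links-parity u) ⟩
      sum (λ v → ⟦ adj join u v ⟧ + 2 * h v)    ≡⟨ ∑-distrib-+ (⟦_⟧ ∘ adj join u) _ ⟩
      # (adj join u) + sum (λ v → 2 * h v)      ≡⟨ cong₂ _+_ (∣tabulate∣ (adj join u)) (*-distribˡ-sum 2 h) ⟨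
      degree join u + 2 * sum h                 ∎)
      where
      open ≡-Reasoning
      h : Fin n → ℕ
      h = proj₁ ∘ links-parity u

    join⊆G : SpanningSubgraph join G
    join⊆G u v e with u ≟ v
    ... | no u≢v with links u v in eq
    ...   | suc _ with i , pos ← sum-positive (λ i → 𝟙 (π i ≟ u) * 𝟙 (π (f i) ≟ v))
                                   (subst (1 ≤_) (sym eq) (s≤s z≤n))
            with π i ≟ u | π (f i) ≟ v
    ...     | yes refl | yes refl = [ (λ p → contradiction p u≢v) , id ]′
                                      (blowup-edge⁻¹ (edge i (perfect i)))

  module _ (B : Barrier blowup (λ _ → 1)) where
    open Barrier B

    alive? : ∀ v → Dec (∃[ i ] π i ≡ v × removed i ≡ false)
    alive? v = any? (λ i → (π i ≟ v) ×-dec (removed i Bool.≟ false))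

    projected-label : ∀ {v} → Dec (∃[ i ] π i ≡ v × removed i ≡ false) → Fin (suc labels)
    projected-label (yes (i , _)) = suc (label i)
    projected-label (no _) = zero

    -- Makes the choice of a surviving copy in `projected-label` immaterial.
    label-close : ∀ i j → removed i ≡ false → removed j ≡ false →
                  π i ≡ π j ⊎ Adjacent G (π i) (π j) → label i ≡ label j
    label-close i j ri rj e with i ≟ j
    ... | yes refl = refl
    ... | no i≢j = compatible i j (blowup-edge i≢j e) ri rj

    project : (b : Fin n → ℕ) → (∀ v → sum (λ i → 𝟙 (π i ≟ v)) ≡ b v) → Barrier G b
    project b fibre = record
      { removed = dead
      ; label = λ v → projected-label (alive? v)
      ; used = λ { zero → false ; (suc l) → used l }
      ; compatible = compatible′
      ; inhabited = λ { (suc l) ul → inhabited′ l ul }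
      ; many = ≤-trans (+-monoˡ-≤ 2 weight) many }
      where
      -- A vertex is removed only when all its copies are, so its weight `b v` is paid for by
      -- removed copies. A vertex with `b v ≡ 0` has no copies and is removed at no cost.
      dead : Fin n → Bool
      dead v = not (does (alive? v))

      compatible′ : ∀ u v → Adjacent G u v → dead u ≡ false → dead v ≡ false →
                    projected-label (alive? u) ≡ projected-label (alive? v)
      compatible′ u v uv du dv with alive? u | alive? v
      ... | yes (i , refl , ri) | yes (j , refl , rj) = cong suc (label-close i j ri rj (inj₂ uv))

      inhabited′ : ∀ l → used l ≡ true →
                   ∃[ v ] (dead v ≡ false × projected-label (alive? v) ≡ suc l)
      inhabited′ l ul with i , ri , refl ← inhabited l ul =
        π i , cong not (dec-true (alive? (π i)) (i , refl , ri)) , lab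
        where
        lab : projected-label (alive? (π i)) ≡ suc (label i)
        lab with alive? (π i)
        ... | yes (j , πj , rj) = cong suc (label-close j i rj ri (inj₁ πj))
        ... | no none = contradiction (i , refl , ri) none

      dead≤removed : ∀ i → ⟦ dead (π i) ⟧ ≤ ⟦ removed i ⟧ * 1
      dead≤removed i with removed i in ri
      ... | true = ⟦⟧≤1 (dead (π i))
      ... | false rewrite dec-true (alive? (π i)) (i , refl , ri) = z≤n

      weight : sum (λ v → ⟦ dead v ⟧ * b v) ≤ sum (λ i → ⟦ removed i ⟧ * 1)
      weight = begin
        sum (λ v → ⟦ dead v ⟧ * b v)
          ≡⟨ sum-cong-≗ (λ v → trans (cong (⟦ dead v ⟧ *_) (sym (fibre v)))
                                     (*-distribˡ-sum ⟦ dead v ⟧ (λ i → 𝟙 (π i ≟ v)))) ⟩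
        sum (λ v → sum (λ i → ⟦ dead v ⟧ * 𝟙 (π i ≟ v)))
          ≡⟨ ∑-comm (λ v i → ⟦ dead v ⟧ * 𝟙 (π i ≟ v)) ⟩
        sum (λ i → sum (λ v → ⟦ dead v ⟧ * 𝟙 (π i ≟ v)))
          ≡⟨ sum-cong-≗ (λ i → trans (sum-cong-≗ (λ v → *-comm ⟦ dead v ⟧ _))
                                     (sum-pickʳ (π i) (⟦_⟧ ∘ dead))) ⟩
        sum (λ i → ⟦ dead (π i) ⟧)
          ≤⟨ sum-mono-≤ dead≤removed ⟩
        sum (λ i → ⟦ removed i ⟧ * 1) ∎
        where open ≤-Reasoning

bounded-join : ∀ {n} (G : Graph n) (b : Fin n → ℕ) → 2 ∣ sum b →
  (∃[ H ] SpanningSubgraph H G × (∀ v → ∃[ j ] b v ≡ degree H v + 2 * j)) ⊎ Barrier G b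
bounded-join {n} G b even with N , π , fibre ← fibration b
  with tutte (Blowup.blowup G π) (subst (2 ∣_) (sym (size≡ N π fibre)) even)
  where
  size≡ : ∀ N (π : Fin N → Fin n) → (∀ v → sum (λ i → 𝟙 (π i ≟ v)) ≡ b v) → N ≡ sum b
  size≡ N π fibre = begin
    N                                       ≡⟨ trans (sum-const N 1) (*-identityʳ N) ⟨
    sum {N} (λ _ → 1)                       ≡⟨ sum-cong-≗ (λ i → sum-𝟙≟ʳ (π i)) ⟨
    sum (λ i → sum (λ v → 𝟙 (π i ≟ v)))     ≡⟨ ∑-comm (λ i v → 𝟙 (π i ≟ v)) ⟩
    sum (λ v → sum (λ i → 𝟙 (π i ≟ v)))     ≡⟨ sum-cong-≗ fibre ⟩
    sum b                                   ∎
    where open ≡-Reasoning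
... | inj₁ (f , m , perfect) = inj₁ (join m perfect , join⊆G m perfect , λ v →
  let j , eq = join-degree m perfect v in j , trans (sym (fibre v)) eq)
  where open Blowup G π
... | inj₂ B = inj₂ (Blowup.project G π B b fibre)

-- From bounded joins to strong parity factors by complementation

handshake : ∀ {n} (G : Graph n) → sum (λ u → # (adj G u)) ≡ 2 * size G
handshake {n} G = begin
  sum (λ u → # (adj G u))
    ≡⟨ sum-cong-≗ (λ u → trans (sum-cong-≗ (split u)) (∑-distrib-+ (λ v → ⟦ up u v ⟧) _)) ⟩
  sum (λ u → # (up u) + sum (λ v → ⟦ up v u ⟧))
    ≡⟨ ∑-distrib-+ (λ u → # (up u)) _ ⟩
  sum (λ u → # (up u)) + sum (λ u → sum (λ v → ⟦ up v u ⟧))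
    ≡⟨ cong (sum (λ u → # (up u)) +_) (∑-comm (λ u v → ⟦ up v u ⟧)) ⟩
  sum (λ u → # (up u)) + sum (λ u → # (up u))
    ≡⟨ cong₂ _+_ size≡ size≡ ⟩
  size G + size G
    ≡⟨ cong (size G +_) (+-identityʳ (size G)) ⟨
  2 * size G ∎
  where
  open ≡-Reasoning
  up : Fin n → Fin n → Bool
  up u v = does (u <? v) ∧ adj G u v

  size≡ : sum (λ u → # (up u)) ≡ size G
  size≡ = sum-cong-≗ (λ u → sym (∣tabulate∣ (up u)))

  split : ∀ u v → ⟦ adj G u v ⟧ ≡ ⟦ up u v ⟧ + ⟦ up v u ⟧
  split u v with Fin.<-cmp u v
  ... | tri< a _ c rewrite dec-true (u <? v) a | dec-false (v <? u) c = sym (+-identityʳ _)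
  ... | tri≈ a refl c rewrite dec-false (u <? u) a | adj-irrefl G u = refl
  ... | tri> a _ c rewrite dec-false (u <? v) a | dec-true (v <? u) c = cong ⟦_⟧ (adj-sym G u v)

module _ {n} (G : Graph n) {k} (k-even : 2 ∣ k) (k<deg : ∀ v → k < # (adj G v))
         (X : Subset n) (X-even : 2 ∣ ∣ X ∣) where

  -- The least admissible degree in the factor; the other admissible degrees exceed it by even
  -- numbers.
  demand : Fin n → ℕ
  demand v = if lookup X v then 1 else k

  demand≤degree : ∀ v → demand v ≤ # (adj G v)
  demand≤degree v with lookup X v
  ... | true = ≤-trans (s≤s z≤n) (k<deg v)
  ... | false = <⇒≤ (k<deg v)

  surplus : Fin n → ℕ
  surplus v = # (adj G v) ∸ demand v

  demand+surplus : ∀ v → demand v + surplus v ≡ # (adj G v)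
  demand+surplus v = m+[n∸m]≡n (demand≤degree v)

  deg≤surplus+k : 1 ≤ k → ∀ v → # (adj G v) ≤ surplus v + k
  deg≤surplus+k 1≤k v = ≤-trans (≤-reflexive (trans (sym (demand+surplus v)) (+-comm (demand v) _)))
    (+-monoʳ-≤ (surplus v) demand≤k)
    where
    demand≤k : demand v ≤ k
    demand≤k with lookup X v
    ... | true = 1≤k
    ... | false = ≤-refl

  demand-even : 2 ∣ sum demand
  demand-even = subst (2 ∣_) (sym eq) (∣m∣n⇒∣m+n X-even (m∣m*n (sum half)))
    where
    open _∣_ k-even renaming (quotient to q; equality to k≡q*2)
    half : Fin n → ℕ
    half v = q * ⟦ not (lookup X v) ⟧
    pointwise : ∀ v → demand v ≡ ⟦ lookup X v ⟧ + 2 * half v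
    pointwise v with lookup X v
    ... | true rewrite *-zeroʳ q = refl
    ... | false rewrite *-identityʳ q = trans k≡q*2 (*-comm q 2)
    eq : sum demand ≡ ∣ X ∣ + 2 * sum half
    eq = trans (sum-cong-≗ pointwise) (trans (∑-distrib-+ (⟦_⟧ ∘ lookup X) _) (cong₂ _+_
      (trans (sym (∣tabulate∣ (lookup X))) (cong ∣_∣ (tabulate∘lookup X)))
      (sym (*-distribˡ-sum 2 half))))

  surplus-even : 2 ∣ sum surplus
  surplus-even = ∣m+n∣m⇒∣n (subst (2 ∣_) (sym eq) (m∣m*n (size G))) demand-even
    where
    eq : sum demand + sum surplus ≡ 2 * size G
    eq = trans (sym (∑-distrib-+ demand surplus))
               (trans (sum-cong-≗ demand+surplus) (handshake G))

  delete : ∀ (H : Graph n) → Graph n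
  delete H .adj u v = adj G u v ∧ not (adj H u v)
  delete H .adj-sym u v = cong₂ _∧_ (adj-sym G u v) (cong not (adj-sym H u v))
  delete H .adj-irrefl v rewrite adj-irrefl G v = refl

  delete-degree : ∀ {H} → SpanningSubgraph H G → ∀ v →
                  degree H v + degree (delete H) v ≡ # (adj G v)
  delete-degree {H} H⊆G v = trans (cong₂ _+_ (∣tabulate∣ (adj H v)) (∣tabulate∣ (adj (delete H) v)))
    (trans (sym (∑-distrib-+ (⟦_⟧ ∘ adj H v) _)) (sum-cong-≗ pointwise))
    where
    pointwise : ∀ u → ⟦ adj H v u ⟧ + ⟦ adj G v u ∧ not (adj H v u) ⟧ ≡ ⟦ adj G v u ⟧
    pointwise u with adj H v u in eq
    ... | true rewrite H⊆G v u eq = refl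
    ... | false = cong ⟦_⟧ (Bool.∧-identityʳ (adj G v u))

  strong-parity-or-barrier :
    (∃[ F ] SpanningSubgraph F G
          × (∀ u → u ∈ X → degree F u % 2 ≡ 1)
          × (∀ v → v ∉ X → ∃[ j ] degree F v ≡ k + 2 * j))
    ⊎ Barrier G surplus
  strong-parity-or-barrier with bounded-join G surplus surplus-even
  ... | inj₂ B = inj₂ B
  ... | inj₁ (H , H⊆G , deg) = inj₁ (delete H , sub , odd-on-X , even-off-X)
    where
    sub : SpanningSubgraph (delete H) G
    sub u v e with adj G u v
    ... | true = refl

    rearr : ∀ a b c → a + (b + c) ≡ b + (a + c)
    rearr = solve-∀

    degree-F : ∀ v → ∃[ j ] degree (delete H) v ≡ demand v + 2 * j
    degree-F v with j , eq ← deg v = j , +-cancelˡ-≡ (degree H v) _ _ (begin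
      degree H v + degree (delete H) v ≡⟨ delete-degree {H} H⊆G v ⟩
      # (adj G v) ≡⟨ demand+surplus v ⟨
      demand v + surplus v ≡⟨ cong (demand v +_) eq ⟩
      demand v + (degree H v + 2 * j) ≡⟨ rearr (demand v) (degree H v) (2 * j) ⟩
      degree H v + (demand v + 2 * j) ∎)
      where open ≡-Reasoning

    odd-on-X : ∀ u → u ∈ X → degree (delete H) u % 2 ≡ 1
    odd-on-X u u∈X with j , eq ← degree-F u =
      trans (cong (_% 2) (trans eq (cong₂ _+_
              (cong (λ x → if x then 1 else k) ([]=⇒lookup u∈X)) (*-comm 2 j))))
            ([m+kn]%n≡m%n 1 j 2)

    even-off-X : ∀ v → v ∉ X → ∃[ j ] degree (delete H) v ≡ k + 2 * j
    even-off-X v v∉X with j , eq ← degree-F v =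
      j , trans eq (cong (λ x → (if x then 1 else k) + 2 * j)
                         (≢true⇒≡false (v∉X ∘ lookup⇒[]= v X)))

-- Arithmetic of the size bound

-- In a class of size c ≤ δ every vertex has at least δ + 1 - c removed
-- neighbours, and c (δ + 1 - c) ≥ δ.
small-class-bound : ∀ {c δ o} → 1 ≤ c → c ≤ δ → c * suc δ ≤ o + c * c → δ ≤ o
small-class-bound {suc a} {δ} {o} _ c≤δ h with e , refl ← m≤n⇒∃[o]m+o≡n c≤δ =
  +-cancelʳ-≤ (suc a * suc a) _ _ (begin
    suc a + e + suc a * suc a           ≤⟨ m≤m+n _ (a * e) ⟩
    suc a + e + suc a * suc a + a * e   ≡⟨ identity a e ⟩
    suc a * suc (suc a + e)             ≤⟨ h ⟩
    o + suc a * suc a                   ∎)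
  where
  open ≤-Reasoning
  identity : ∀ a e → suc a + e + suc a * suc a + a * e ≡ suc a * suc (suc a + e)
  identity = solve-∀

m≤m² : ∀ m → m ≤ m * m
m≤m² zero = z≤n
m≤m² (suc m) = m≤m+n (suc m) (m * suc m)

module _ {k D′ t p : ℕ} where

  private
    D δ : ℕ
    D = suc D′
    δ = k + D

  k<δ : k < δ
  k<δ = m<m+n k (s≤s z≤n)

  -- A small class takes δ ≥ k + 1 edges. If `t ≤ p`, the allowance `k * t + p` is at most
  -- `(k + 1) * p` and cannot exceed this cost.
  few-small-classes : ∀ {Q d} → δ * p + Q ≤ d → d + 2 ≤ k * t + (p + Q) → p < t
  few-small-classes {Q} {d} out deficient = ≰⇒> λ t≤p → <⇒≱ (m<m+n (δ * p + Q) (s≤s z≤n)) (begin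
    δ * p + Q + 2         ≤⟨ +-monoˡ-≤ 2 out ⟩
    d + 2                 ≤⟨ deficient ⟩
    k * t + (p + Q)       ≤⟨ +-monoˡ-≤ (p + Q) (*-monoʳ-≤ k t≤p) ⟩
    k * p + (p + Q)       ≡⟨ identity k p Q ⟩
    suc k * p + Q         ≤⟨ +-monoˡ-≤ Q (*-monoˡ-≤ p k<δ) ⟩
    δ * p + Q             ∎)
    where
    open ≤-Reasoning
    identity : ∀ k p Q → k * p + (p + Q) ≡ suc k * p + Q
    identity = solve-∀

  many-classes : ∀ {m d} → δ * t ≤ d → d + 2 ≤ k * t + m → D * t + 2 ≤ m
  many-classes {m} {d} deg deficient = +-cancelˡ-≤ (k * t) _ _ (begin
    k * t + (D * t + 2)   ≡⟨ identity k D t ⟩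
    δ * t + 2             ≤⟨ +-monoˡ-≤ 2 deg ⟩
    d + 2                 ≤⟨ deficient ⟩
    k * t + m             ∎)
    where
    open ≤-Reasoning
    identity : ∀ k D t → k * t + (D * t + 2) ≡ (k + D) * t + 2
    identity = solve-∀

  -- The right side bounds from below the vertices outside one big class: `t` removed ones, at least
  -- one per small class, at least δ + 1 in each of the `q` other big classes. From `p < t`, hence
  -- `t ≥ 1`, and the number of classes follows `q ≥ D + 1`, and already `q * δ` exceeds `D * δ`.
  many-outside : ∀ {q} → p < t → D * t + 2 ≤ p + suc q →
                 D * δ + 1 ≤ t + p + q * suc δ
  many-outside {q} p<t many = begin
    D * δ + 1                        ≤⟨ m≤m+n _ _ ⟩
    D * δ + 1 + (p + δ + p + q)      ≡⟨ identity₂ D δ p q ⟩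
    suc p + p + (q + (D + 1) * δ)    ≤⟨ +-mono-≤ (+-monoˡ-≤ p p<t) (+-monoʳ-≤ q (*-monoˡ-≤ δ q-large)) ⟩
    t + p + (q + q * δ)              ≡⟨ cong (t + p +_) (*-suc q δ) ⟨
    t + p + q * suc δ                ∎
    where
    open ≤-Reasoning
    identity₁ : ∀ D′ p → suc D′ + 1 + suc p ≡ D′ * 1 + suc p + 2
    identity₁ = solve-∀
    identity₂ : ∀ D δ p q → D * δ + 1 + (p + δ + p + q) ≡ suc p + p + (q + (D + 1) * δ)
    identity₂ = solve-∀
    identity₃ : ∀ D′ t → D′ * t + t + 2 ≡ suc D′ * t + 2
    identity₃ = solve-∀
    identity₄ : ∀ p q → p + suc q ≡ q + suc p
    identity₄ = solve-∀
    q-large : D + 1 ≤ q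
    q-large = +-cancelʳ-≤ (suc p) _ _ (begin
      D + 1 + suc p              ≡⟨ identity₁ D′ p ⟩
      D′ * 1 + suc p + 2         ≤⟨ +-monoˡ-≤ 2 (+-mono-≤ (*-monoʳ-≤ D′ (≤-trans (s≤s z≤n) p<t)) p<t) ⟩
      D′ * t + t + 2             ≡⟨ identity₃ D′ t ⟩
      D * t + 2                  ≤⟨ many ⟩
      p + suc q                  ≡⟨ identity₄ p q ⟩
      q + suc p                  ∎)

  module _ {N′ d e₂ S SQ : ℕ}
           (order : t + S ≡ D * δ + 1 + N′)
           (edges : e₂ + S ≤ 2 * d + SQ) where

    -- By convexity the worst case puts the whole excess `E` into one big class, which then has
    -- `a = suc δ + E` vertices. Let `j` be the number by which the vertices outside it exceed
    -- `D * δ + 1`; then `N′ = a + j`, and the cross terms of `(a + j) * (a + j)` absorb what these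
    -- `j` vertices add to the edge count.
    size-bound-big : ∀ {q E} → S ≡ p + suc δ * suc q + E →
      SQ ≤ p + suc δ * suc δ * suc q + 2 * suc δ * E + E * E →
      δ * p + suc q ≤ d → δ * t ≤ d → d + 2 ≤ k * t + (p + suc q) →
      e₂ + N′ < N′ * N′ + 2 * (D * δ + 1) * δ
    size-bound-big {q} {E} S≡ SQ≤ out deg deficient
      with j , W≡ ← m≤n⇒∃[o]m+o≡n (many-outside {q} (few-small-classes out deficient)
                                                     (many-classes deg deficient))
      -- Adding `p + q * suc δ` completes `a` to `S`, so that `edges` applies; the extra 2 turns
      -- `2 * d` into `2 * (d + 1)`, which `deficient` bounds strictly.
      = +-cancelʳ-< (p + q * suc δ + 2) _ _ (begin-strict
      e₂ + N′ + (p + q * suc δ + 2)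
        ≡⟨ cong (λ x → e₂ + x + (p + q * suc δ + 2)) N′≡ ⟩
      e₂ + (a + j) + (p + q * suc δ + 2)
        ≡⟨ identity₁ e₂ E j p q δ ⟩
      e₂ + (p + suc δ * suc q + E) + j + 2
        ≡⟨ cong (λ x → e₂ + x + j + 2) S≡ ⟨
      e₂ + S + j + 2
        ≤⟨ +-monoˡ-≤ 2 (+-monoˡ-≤ j (≤-trans edges (+-monoʳ-≤ (2 * d) SQ≤))) ⟩
      2 * d + (p + suc δ * suc δ * suc q + 2 * suc δ * E + E * E) + j + 2
        ≡⟨ identity₂ d p δ q E j ⟩
      2 * (d + 1) + (p + suc δ * suc δ * q + a * a + j)
        <⟨ +-monoˡ-< (p + suc δ * suc δ * q + a * a + j) (*-monoʳ-< 2 d+1<) ⟩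
      2 * (k * t + (p + suc q)) + (p + suc δ * suc δ * q + a * a + j)
        ≤⟨ +-mono-≤ (*-monoʳ-≤ 2 (+-mono-≤ (*-monoˡ-≤ t (<⇒≤ k<δ)) (+-monoˡ-≤ (suc q) (m≤n*m p δ ⦃ >-nonZero 1≤δ ⦄))))
                    (+-monoʳ-≤ (p + suc δ * suc δ * q + a * a) (m≤m² j)) ⟩
      2 * (δ * t + (δ * p + suc q)) + (p + suc δ * suc δ * q + a * a + j * j)
        ≤⟨ m≤m+n _ (2 * suc E * j) ⟩
      2 * (δ * t + (δ * p + suc q)) + (p + suc δ * suc δ * q + a * a + j * j) + 2 * suc E * j
        ≡⟨ identity₃ δ t p q a j E ⟩
      a * a + j * j + 2 * suc E * j + 2 * δ * (t + p) + (2 * q + suc δ * suc δ * q) + p + 2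
        ≤⟨ +-monoˡ-≤ 2 (+-monoˡ-≤ p (+-monoʳ-≤ (a * a + j * j + 2 * suc E * j + 2 * δ * (t + p)) q-terms)) ⟩
      a * a + j * j + 2 * suc E * j + 2 * δ * (t + p) + (2 * δ * (q * suc δ) + q * suc δ) + p + 2
        ≡⟨ identity₄ a j E δ (t + p) (q * suc δ) p ⟩
      a * a + j * j + 2 * suc E * j + 2 * δ * (t + p + q * suc δ) + (p + q * suc δ + 2)
        ≡⟨ cong (λ W → a * a + j * j + 2 * suc E * j + 2 * δ * W + (p + q * suc δ + 2)) W≡ ⟨
      a * a + j * j + 2 * suc E * j + 2 * δ * (D * δ + 1 + j) + (p + q * suc δ + 2)
        ≡⟨ cong (_+ (p + q * suc δ + 2)) (identity₅ δ E j (D * δ + 1)) ⟩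
      (a + j) * (a + j) + 2 * (D * δ + 1) * δ + (p + q * suc δ + 2)
        ≡⟨ cong (λ x → x * x + 2 * (D * δ + 1) * δ + (p + q * suc δ + 2)) N′≡ ⟨
      N′ * N′ + 2 * (D * δ + 1) * δ + (p + q * suc δ + 2) ∎)
      where
      open ≤-Reasoning
      a : ℕ
      a = suc δ + E

      1≤δ : 1 ≤ δ
      1≤δ = ≤-trans (s≤s z≤n) k<δ

      d+1< : d + 1 < k * t + (p + suc q)
      d+1< = ≤-trans (≤-reflexive (sym (+-suc d 1))) deficient

      regroup : ∀ t p δ q E → t + (p + suc δ * suc q + E) ≡ t + p + q * suc δ + (suc δ + E)
      regroup = solve-∀
      regroup′ : ∀ r j a → r + j + a ≡ r + (a + j)
      regroup′ = solve-∀

      N′≡ : N′ ≡ a + j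
      N′≡ = sym (+-cancelˡ-≡ (D * δ + 1) _ _ (begin-equality
        D * δ + 1 + (a + j)                 ≡⟨ regroup′ (D * δ + 1) j a ⟨
        D * δ + 1 + j + a                   ≡⟨ cong (_+ a) W≡ ⟩
        t + p + q * suc δ + a               ≡⟨ regroup t p δ q E ⟨
        t + (p + suc δ * suc q + E)         ≡⟨ cong (t +_) S≡ ⟨
        t + S                               ≡⟨ order ⟩
        D * δ + 1 + N′                      ∎))

      identity₁ : ∀ e E j p q δ → e + (suc δ + E + j) + (p + q * suc δ + 2) ≡
                  e + (p + suc δ * suc q + E) + j + 2
      identity₁ = solve-∀
      identity₂ : ∀ d p δ q E j →
        2 * d + (p + suc δ * suc δ * suc q + 2 * suc δ * E + E * E) + j + 2 ≡
        2 * (d + 1) + (p + suc δ * suc δ * q + (suc δ + E) * (suc δ + E) + j)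
      identity₂ = solve-∀
      identity₃ : ∀ δ t p q a j E →
        2 * (δ * t + (δ * p + suc q)) + (p + suc δ * suc δ * q + a * a + j * j) + 2 * suc E * j ≡
        a * a + j * j + 2 * suc E * j + 2 * δ * (t + p) + (2 * q + suc δ * suc δ * q) + p + 2
      identity₃ = solve-∀
      identity₄ : ∀ a j E δ s r p →
        a * a + j * j + 2 * suc E * j + 2 * δ * s + (2 * δ * r + r) + p + 2 ≡
        a * a + j * j + 2 * suc E * j + 2 * δ * (s + r) + (p + r + 2)
      identity₄ = solve-∀
      identity₅ : ∀ δ E j r →
        (suc δ + E) * (suc δ + E) + j * j + 2 * suc E * j + 2 * δ * (r + j) ≡
        (suc δ + E + j) * (suc δ + E + j) + 2 * r * δ
      identity₅ = solve-∀
      -- Per unit of `q` this is (δ + 1)² + 2 ≤ (2δ + 1)(δ + 1), true for δ ≥ 1; with δ = 1 + i the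
      -- difference is i² + 3i.
      q-terms : 2 * q + suc δ * suc δ * q ≤ 2 * δ * (q * suc δ) + q * suc δ
      q-terms with i , δ≡ ← m≤n⇒∃[o]m+o≡n 1≤δ rewrite sym δ≡ =
        ≤-trans (m≤m+n _ (q * (i * i + 3 * i))) (≤-reflexive (identity₆ q i))
        where
        identity₆ : ∀ q i → 2 * q + suc (1 + i) * suc (1 + i) * q + q * (i * i + 3 * i) ≡
                    2 * (1 + i) * (q * suc (1 + i)) + q * suc (1 + i)
        identity₆ = solve-∀

    -- With every class of at most δ vertices, `2 * d + δ * S` stays below `2 * δ * (t + S)`, up to
    -- a spare `S`. So the degree sum is below 2δ times the order, linear in `N′`, and
    -- `N′ ≥ 2 * δ + 1` lets the square win.
    size-bound-small : 2 * δ + 1 ≤ N′ → p ≤ S → SQ ≤ δ * S → d + 2 ≤ k * t + p →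
                       e₂ + N′ < N′ * N′ + 2 * (D * δ + 1) * δ
    size-bound-small N′-large p≤S SQ≤ deficient = +-cancelʳ-< S _ _ (begin-strict
      e₂ + N′ + S                             ≡⟨ identity₁ e₂ N′ S ⟩
      e₂ + S + N′                             ≤⟨ +-monoˡ-≤ N′ (≤-trans edges (+-monoʳ-≤ (2 * d) SQ≤)) ⟩
      2 * d + δ * S + N′                      <⟨ +-monoˡ-< N′ (+-monoˡ-< (δ * S) (*-monoʳ-< 2 d<)) ⟩
      2 * (k * t + S) + δ * S + N′            ≤⟨ +-monoˡ-≤ N′ (+-monoˡ-≤ (δ * S) (*-monoʳ-≤ 2 (+-monoˡ-≤ S (*-monoˡ-≤ t (<⇒≤ k<δ))))) ⟩
      2 * (δ * t + S) + δ * S + N′            ≡⟨ identity₂ δ t S N′ ⟩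
      2 * δ * t + 1 * S + δ * S + N′ + S      ≤⟨ +-monoˡ-≤ S (+-monoˡ-≤ N′ (+-monoˡ-≤ (δ * S) (+-monoʳ-≤ (2 * δ * t) (*-monoˡ-≤ S 1≤δ)))) ⟩
      2 * δ * t + δ * S + δ * S + N′ + S      ≡⟨ cong (_+ S) (identity₃ δ t S N′) ⟩
      2 * δ * (t + S) + N′ + S                ≡⟨ cong (λ x → 2 * δ * x + N′ + S) order ⟩
      2 * δ * (D * δ + 1 + N′) + N′ + S       ≡⟨ cong (_+ S) (identity₄ δ (D * δ + 1) N′) ⟩
      (2 * δ + 1) * N′ + 2 * (D * δ + 1) * δ + S
        ≤⟨ +-monoˡ-≤ S (+-monoˡ-≤ (2 * (D * δ + 1) * δ) (*-monoˡ-≤ N′ N′-large)) ⟩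
      N′ * N′ + 2 * (D * δ + 1) * δ + S       ∎)
      where
      open ≤-Reasoning
      1≤δ : 1 ≤ δ
      1≤δ = ≤-trans (s≤s z≤n) k<δ
      d< : d < k * t + S
      d< = ≤-trans (≤-trans (≤-reflexive (+-comm 1 d)) (+-monoʳ-≤ d (s≤s z≤n)))
                   (≤-trans deficient (+-monoʳ-≤ (k * t) p≤S))
      identity₁ : ∀ e N S → e + N + S ≡ e + S + N
      identity₁ = solve-∀
      identity₂ : ∀ δ t S N → 2 * (δ * t + S) + δ * S + N ≡ 2 * δ * t + 1 * S + δ * S + N + S
      identity₂ = solve-∀
      identity₃ : ∀ δ t S N → 2 * δ * t + δ * S + δ * S + N ≡ 2 * δ * (t + S) + N
      identity₃ = solve-∀
      identity₄ : ∀ δ r N → 2 * δ * (r + N) + N ≡ (2 * δ + 1) * N + 2 * r * δ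
      identity₄ = solve-∀

-- Counting edges around a barrier

sum-square : ∀ {n} (f : Fin n → ℕ) → sum (λ i → f i * f i) ≤ sum f * sum f
sum-square f = ≤-trans (sum-mono-≤ (λ i → *-monoʳ-≤ (f i) (term≤sum f i)))
  (≤-reflexive (sym (*-distribʳ-sum (sum f) f)))

module _ (δ : ℕ) where

  small big : ℕ → ℕ
  small c = 𝟙 ((1 ≤? c) ×-dec (c ≤? δ))
  big c = 𝟙 (suc δ ≤? c)

  data Kind (c : ℕ) : Set where
    is-empty : c ≡ 0 → small c ≡ 0 → big c ≡ 0 → Kind c
    is-small : 1 ≤ c → c ≤ δ → small c ≡ 1 → big c ≡ 0 → Kind c
    is-big   : suc δ ≤ c → small c ≡ 0 → big c ≡ 1 → Kind c

  kind : ∀ c → Kind c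
  kind c with 1 ≤? c | c ≤? δ
  ... | yes 1≤c | yes c≤δ = is-small 1≤c c≤δ
    (𝟙-yes ((1 ≤? c) ×-dec (c ≤? δ)) (1≤c , c≤δ)) (𝟙-no (suc δ ≤? c) (≤⇒≯ c≤δ))
  ... | yes _ | no c≰δ = is-big (≰⇒> c≰δ)
    (𝟙-no ((1 ≤? c) ×-dec (c ≤? δ)) (c≰δ ∘ proj₂)) (𝟙-yes (suc δ ≤? c) (≰⇒> c≰δ))
  ... | no 1≰c | _ with refl ← n<1⇒n≡0 (≰⇒> 1≰c) = is-empty refl refl (𝟙-no (suc δ ≤? 0) λ ())

  -- What a class has beyond the least size of its kind, 1 or δ + 1. Measured this way, the excesses
  -- of all classes can be added up and charged to a single big class.
  excess : ℕ → ℕ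
  excess c = c ∸ (small c + suc δ * big c)

  kind-decomposition : ∀ c → c ≡ small c + suc δ * big c + excess c
  kind-decomposition c = sym (m+[n∸m]≡n (lower (kind c)))
    where
    lower : Kind c → small c + suc δ * big c ≤ c
    lower (is-empty refl s b) rewrite s | b | *-zeroʳ δ = z≤n
    lower (is-small 1≤c _ s b) rewrite s | b | *-zeroʳ δ = 1≤c
    lower (is-big δ<c s b) rewrite s | b | *-identityʳ δ = δ<c

  kind-square : ∀ c → c * c ≤ small c + suc δ * suc δ * big c
                            + 2 * suc δ * excess c + excess c * excess c
  kind-square c with kind c | kind-decomposition c
  ... | is-empty refl _ _ | _ = z≤n
  ... | is-small _ _ s b | eq rewrite s | b = subst (_≤ 1 + suc δ * suc δ * 0 + 2 * suc δ * e + e * e)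
      (cong (λ x → x * x) (sym eq))
      (≤-trans (m≤m+n _ (2 * δ * e)) (≤-reflexive (identity δ e)))
    where
    e : ℕ
    e = c ∸ (1 + suc δ * 0)
    identity : ∀ δ e → (1 + suc δ * 0 + e) * (1 + suc δ * 0 + e) + 2 * δ * e ≡
                       1 + suc δ * suc δ * 0 + 2 * suc δ * e + e * e
    identity = solve-∀
  ... | is-big _ s b | eq rewrite s | b = subst (_≤ 0 + suc δ * suc δ * 1 + 2 * suc δ * e + e * e)
      (cong (λ x → x * x) (sym eq)) (≤-reflexive (identity δ e))
    where
    e : ℕ
    e = c ∸ (0 + suc δ * 1)
    identity : ∀ δ e → (0 + suc δ * 1 + e) * (0 + suc δ * 1 + e) ≡
                       0 + suc δ * suc δ * 1 + 2 * suc δ * e + e * e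
    identity = solve-∀

module _ {n} (G : Graph n) {b : Fin n → ℕ} (B : Barrier G b) where
  open Barrier B

  private
    A : Fin n → Fin n → ℕ
    A u v = ⟦ adj G u v ⟧

    A-sym : ∀ u v → A u v ≡ A v u
    A-sym u v = cong ⟦_⟧ (adj-sym G u v)

    r : Fin n → ℕ
    r v = ⟦ removed v ⟧

  member : Fin labels → Fin n → ℕ
  member j v = ⟦ not (removed v) ⟧ * 𝟙 (label v ≟ j)

  member-self : ∀ {v} → removed v ≡ false → member (label v) v ≡ 1
  member-self {v} rv rewrite rv | dec-true (label v ≟ label v) refl = refl

  member⁻¹ : ∀ {j v} → 1 ≤ member j v → removed v ≡ false × label v ≡ j
  member⁻¹ {j} {v} m with removed v | label v ≟ j
  ... | false | yes l = refl , l

  class : Fin labels → ℕ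
  class j = sum (member j)

  removed-degree : Fin n → ℕ
  removed-degree v = sum (λ u → r u * A v u)

  boundary : Fin labels → ℕ
  boundary j = sum (λ v → member j v * removed-degree v)

  total-removed-degree : ℕ
  total-removed-degree = sum (λ v → r v * # (adj G v))

  sum-member : ∀ v → sum (λ j → member j v) ≡ ⟦ not (removed v) ⟧
  sum-member v = trans (sym (*-distribˡ-sum ⟦ not (removed v) ⟧ (λ j → 𝟙 (label v ≟ j))))
    (trans (cong (⟦ not (removed v) ⟧ *_) (sum-𝟙≟ʳ (label v))) (*-identityʳ _))

  sum-class : sum class ≡ sum (λ v → ⟦ not (removed v) ⟧)
  sum-class = trans (∑-comm member) (sum-cong-≗ sum-member)

  order-split : # removed + sum class ≡ n
  order-split = trans (cong (# removed +_) sum-class)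
    (trans (sym (∑-distrib-+ r _)) (trans (sum-cong-≗ one) (trans (sum-const n 1) (*-identityʳ n))))
    where
    one : ∀ v → r v + ⟦ not (removed v) ⟧ ≡ 1
    one v with removed v
    ... | true = refl
    ... | false = refl

  sum-boundary : sum boundary ≤ total-removed-degree
  sum-boundary = begin
    sum boundary
      ≡⟨ ∑-comm (λ j v → member j v * removed-degree v) ⟩
    sum (λ v → sum (λ j → member j v * removed-degree v))
      ≡⟨ sum-cong-≗ (λ v → trans (sym (*-distribʳ-sum (removed-degree v) (λ j → member j v)))
                                 (cong (_* removed-degree v) (sum-member v))) ⟩
    sum (λ v → ⟦ not (removed v) ⟧ * removed-degree v)
      ≤⟨ sum-mono-≤ (λ v → ≤-trans (*-monoˡ-≤ (removed-degree v) (⟦⟧≤1 (not (removed v))))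
                                   (≤-reflexive (*-identityˡ _))) ⟩
    sum removed-degree
      ≡⟨ ∑-comm (λ v u → r u * A v u) ⟩
    sum (λ u → sum (λ v → r u * A v u))
      ≡⟨ sum-cong-≗ (λ u → trans (sum-cong-≗ (λ v → cong (r u *_) (A-sym v u)))
                                 (sym (*-distribˡ-sum (r u) (A u)))) ⟩
    total-removed-degree ∎
    where open ≤-Reasoning

  -- Over ordered pairs: an adjacent pair has a removed end or lies within one class, and the
  -- squares also count the diagonal, which accounts for `sum class` on the left. Edges between two
  -- removed vertices are counted more often on the right.
  edge-count : 2 * size G + sum class ≤ 2 * total-removed-degree + sum (λ j → class j * class j)
  edge-count = begin
    2 * size G + sum class
      ≡⟨ cong₂ _+_ (sym (handshake G)) (trans sum-class (sum-cong-≗ λ u → sym (sum-pickʳ u (λ _ → ⟦ not (removed u) ⟧)))) ⟩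
    sum (λ u → sum (A u)) + sum (λ u → sum (λ v → 𝟙 (u ≟ v) * ⟦ not (removed u) ⟧))
      ≡⟨ ∑-distrib-+ (λ u → sum (A u)) _ ⟨
    sum (λ u → sum (A u) + sum (λ v → 𝟙 (u ≟ v) * ⟦ not (removed u) ⟧))
      ≡⟨ sum-cong-≗ (λ u → ∑-distrib-+ (A u) _) ⟨
    sum (λ u → sum (λ v → A u v + 𝟙 (u ≟ v) * ⟦ not (removed u) ⟧))
      ≤⟨ sum-mono-≤ (λ u → sum-mono-≤ (pointwise u)) ⟩
    sum (λ u → sum (λ v → r u * A u v + r v * A u v + both u v))
      ≡⟨ sum-cong-≗ (λ u → ∑-distrib-+₃ (λ v → r u * A u v) (λ v → r v * A u v) (both u)) ⟩
    sum (λ u → sum (λ v → r u * A u v) + sum (λ v → r v * A u v) + sum (both u))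
      ≡⟨ ∑-distrib-+₃ (λ u → sum (λ v → r u * A u v)) (λ u → sum (λ v → r v * A u v)) (λ u → sum (both u)) ⟩
    sum (λ u → sum (λ v → r u * A u v)) + sum (λ u → sum (λ v → r v * A u v)) + sum (λ u → sum (both u))
      ≡⟨ cong₂ _+_ (cong₂ _+_ first second) third ⟩
    total-removed-degree + total-removed-degree + sum (λ j → class j * class j)
      ≡⟨ cong (λ x → total-removed-degree + x + sum (λ j → class j * class j)) (+-identityʳ total-removed-degree) ⟨
    2 * total-removed-degree + sum (λ j → class j * class j) ∎
    where
    open ≤-Reasoning
    both : Fin n → Fin n → ℕ
    both u v = sum (λ j → member j u * member j v)

    first : sum (λ u → sum (λ v → r u * A u v)) ≡ total-removed-degree
    first = sum-cong-≗ (λ u → sym (*-distribˡ-sum (r u) (A u)))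

    second : sum (λ u → sum (λ v → r v * A u v)) ≡ total-removed-degree
    second = trans (∑-comm (λ u v → r v * A u v)) (sum-cong-≗ (λ v →
      trans (sum-cong-≗ (λ u → cong (r v *_) (A-sym u v))) (sym (*-distribˡ-sum (r v) (A v)))))

    third : sum (λ u → sum (both u)) ≡ sum (λ j → class j * class j)
    third = trans (sum-cong-≗ (λ u → ∑-comm (λ v j → member j u * member j v)))
      (trans (∑-comm (λ u j → sum (λ v → member j u * member j v)))
      (sum-cong-≗ (λ j → trans (sum-cong-≗ (λ u → sym (*-distribˡ-sum (member j u) (member j))))
                               (sym (*-distribʳ-sum (class j) (member j))))))

    same : ∀ u v → removed u ≡ false → removed v ≡ false → label u ≡ label v → 1 ≤ both u v
    same u v ru rv l = ≤-trans
      (≤-reflexive (sym (cong₂ _*_ (member-self ru) (trans (cong (λ j → member j v) l) (member-self rv)))))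
      (term≤sum (λ j → member j u * member j v) (label u))

    close : ∀ {u v} → removed u ≡ false → removed v ≡ false → A u v + 𝟙 (u ≟ v) ≤ both u v
    close {u} {v} ru rv with adj G u v in uv | u ≟ v
    ... | true | yes refl with () ← trans (sym uv) (adj-irrefl G u)
    ... | true | no _ = same u v ru rv (compatible u v uv ru rv)
    ... | false | yes refl = same u u ru ru refl
    ... | false | no _ = z≤n

    distinct : ∀ {u v} → removed u ≡ false → removed v ≡ true → 𝟙 (u ≟ v) ≡ 0
    distinct {u} {v} ru rv = 𝟙-no (u ≟ v) λ { refl → contradiction (trans (sym rv) ru) λ () }

    cases : ∀ x y a e z → (x ≡ false → y ≡ false → a + e ≤ z) → (x ≡ false → y ≡ true → e ≡ 0) →
            a + e * ⟦ not x ⟧ ≤ ⟦ x ⟧ * a + ⟦ y ⟧ * a + z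
    cases true y a e z _ _ rewrite *-zeroʳ e | +-identityʳ a =
      ≤-trans (m≤m+n a (⟦ y ⟧ * a)) (m≤m+n (a + ⟦ y ⟧ * a) z)
    cases false true a e z _ e≡0 rewrite e≡0 refl refl | +-identityʳ a = m≤m+n a z
    cases false false a e z a+e≤z _ rewrite *-identityʳ e = a+e≤z refl refl

    pointwise : ∀ u v → A u v + 𝟙 (u ≟ v) * ⟦ not (removed u) ⟧ ≤ r u * A u v + r v * A u v + both u v
    pointwise u v = cases (removed u) (removed v) (A u v) (𝟙 (u ≟ v)) (both u v) close distinct

  -- The closed neighbourhood of `v` lies in the removed set together with the class of `v`; the
  -- `suc` is `v` itself.
  class-edges : ∀ {v} → removed v ≡ false →
                suc (# (adj G v)) ≤ removed-degree v + class (label v)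
  class-edges {v} rv = begin
    suc (# (adj G v))                           ≡⟨ +-comm 1 _ ⟩
    # (adj G v) + 1                             ≡⟨ cong (# (adj G v) +_) (sum-𝟙≟ʳ v) ⟨
    # (adj G v) + sum (λ u → 𝟙 (v ≟ u))         ≡⟨ ∑-distrib-+ (A v) _ ⟨
    sum (λ u → A v u + 𝟙 (v ≟ u))               ≤⟨ sum-mono-≤ pointwise ⟩
    sum (λ u → r u * A v u + member (label v) u) ≡⟨ ∑-distrib-+ (λ u → r u * A v u) _ ⟩
    removed-degree v + class (label v)          ∎
    where
    open ≤-Reasoning
    pointwise : ∀ u → A v u + 𝟙 (v ≟ u) ≤ r u * A v u + member (label v) u
    pointwise u with v ≟ u
    ... | yes refl rewrite adj-irrefl G v | member-self rv | rv = ≤-refl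
    ... | no _ with adj G v u in vu | removed u in ru
    ...   | false | _ = z≤n
    ...   | true | true = s≤s z≤n
    ...   | true | false rewrite dec-true (label u ≟ label v) (sym (compatible v u vu rv ru)) = ≤-refl

  small-boundary : ∀ {δ} → (∀ v → δ ≤ # (adj G v)) → ∀ j → 1 ≤ class j → class j ≤ δ →
                   δ ≤ boundary j
  small-boundary {δ} δ≤deg j 1≤c c≤δ = small-class-bound 1≤c c≤δ (begin
    class j * suc δ
      ≡⟨ *-distribʳ-sum (suc δ) (member j) ⟩
    sum (λ v → member j v * suc δ)
      ≤⟨ sum-mono-≤ pointwise ⟩
    sum (λ v → member j v * removed-degree v + member j v * class j)
      ≡⟨ ∑-distrib-+ (λ v → member j v * removed-degree v) _ ⟩
    boundary j + sum (λ v → member j v * class j)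
      ≡⟨ cong (boundary j +_) (*-distribʳ-sum (class j) (member j)) ⟨
    boundary j + class j * class j ∎)
    where
    open ≤-Reasoning
    pointwise : ∀ v → member j v * suc δ ≤ member j v * removed-degree v + member j v * class j
    pointwise v with removed v in rv | label v ≟ j
    ... | true | _ = z≤n
    ... | false | no _ = z≤n
    ... | false | yes refl = begin
      1 * suc δ                                      ≡⟨ *-identityˡ (suc δ) ⟩
      suc δ                                          ≤⟨ s≤s (δ≤deg v) ⟩
      suc (# (adj G v))                              ≤⟨ class-edges rv ⟩
      removed-degree v + class j                     ≡⟨ cong₂ _+_ (*-identityˡ (removed-degree v)) (*-identityˡ (class j)) ⟨
      1 * removed-degree v + 1 * class j             ∎

  -- A class without removed neighbours is everything, by connectedness.
  class-boundary : Connected G → ∀ j → 1 ≤ class j → 1 ≤ boundary j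
  class-boundary connected j 1≤c with 1 ≤? boundary j
  ... | yes ok = ok
  -- `many` asks for at least two used labels, whereas every vertex is reached from class `j` and so
  -- carries label `j`.
  ... | no isolated = contradiction
          (≤-trans (m≤n+m 2 (sum (λ v → r v * b v))) (≤-trans many used≤1)) λ { (s≤s ()) }
    where
    In : Fin n → Set
    In v = removed v ≡ false × label v ≡ j

    closed : ∀ {u v} → In u → Adjacent G u v → In v
    closed {u} {v} (ru , refl) uv with removed v in rv
    ... | false = refl , sym (compatible u v uv ru rv)
    ... | true = contradiction (begin
      1                                        ≡⟨ cong₂ (λ x y → ⟦ x ⟧ * ⟦ y ⟧) rv uv ⟨
      r v * A u v                              ≤⟨ term≤sum (λ v → r v * A u v) v ⟩
      removed-degree u                         ≡⟨ *-identityˡ _ ⟨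
      1 * removed-degree u                     ≡⟨ cong (_* removed-degree u) (member-self ru) ⟨
      member j u * removed-degree u            ≤⟨ term≤sum (λ v → member j v * removed-degree v) u ⟩
      boundary j                               ∎) isolated
      where open ≤-Reasoning

    reach : ∀ {u v} → Star (Adjacent G) u v → In u → In v
    reach ε iu = iu
    reach (uv ◅ vw) iu = reach vw (closed iu uv)

    origin : ∃[ v ] In v
    origin with v , m ← sum-positive (member j) 1≤c = v , member⁻¹ m

    pointwise : ∀ i → ⟦ used i ⟧ ≤ 𝟙 (i ≟ j)
    pointwise i with used i in ui
    ... | false = z≤n
    ... | true with v , rv , lv ← inhabited i ui =
      ≤-reflexive (sym (𝟙-yes (i ≟ j)
        (trans (sym lv) (proj₂ (reach (connected (proj₁ origin) v) (proj₂ origin))))))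

    used≤1 : # used ≤ 1
    used≤1 = ≤-trans (sum-mono-≤ pointwise) (≤-reflexive (sum-𝟙≟ j))

  used⇒inhabited : ∀ j → used j ≡ true → 1 ≤ class j
  used⇒inhabited j uj with v , rv , refl ← inhabited j uj =
    ≤-trans (≤-reflexive (sym (member-self rv))) (term≤sum (member j) v)

  module _ {k D′ : ℕ} (connected : Connected G)
           (δ≤deg : ∀ v → k + suc D′ ≤ # (adj G v)) (deg≤ : ∀ v → # (adj G v) ≤ b v + k) where

    private
      δ d t p Q E : ℕ
      δ = k + suc D′
      d = total-removed-degree
      t = # removed
      p = sum (small δ ∘ class)
      Q = sum (big δ ∘ class)
      E = sum (excess δ ∘ class)

    boundary-bound : δ * p + Q ≤ d
    boundary-bound = begin
      δ * p + Q
        ≡⟨ cong (_+ Q) (*-distribˡ-sum δ (small δ ∘ class)) ⟩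
      sum (λ j → δ * small δ (class j)) + Q
        ≡⟨ ∑-distrib-+ (λ j → δ * small δ (class j)) _ ⟨
      sum (λ j → δ * small δ (class j) + big δ (class j))
        ≤⟨ sum-mono-≤ pointwise ⟩
      sum boundary
        ≤⟨ sum-boundary ⟩
      d ∎
      where
      open ≤-Reasoning
      pointwise : ∀ j → δ * small δ (class j) + big δ (class j) ≤ boundary j
      pointwise j with kind δ (class j)
      ... | is-empty _ s b rewrite s | b | *-zeroʳ δ = z≤n
      ... | is-small 1≤c c≤δ s b rewrite s | b | *-identityʳ δ | +-identityʳ δ =
        small-boundary δ≤deg j 1≤c c≤δ
      ... | is-big δ<c s b rewrite s | b | *-zeroʳ δ =
        class-boundary connected j (≤-trans (s≤s z≤n) δ<c)

    -- The deficiency of the barrier with `b` traded for degrees, at a cost of at most `k` per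
    -- removed vertex. Nonempty classes that are not `used` enter `p + Q` too and only enlarge the
    -- right side.
    removed-degree-bound : d + 2 ≤ k * t + (p + Q)
    removed-degree-bound = begin
      d + 2
        ≤⟨ +-monoˡ-≤ 2 (sum-mono-≤ (λ v → *-monoʳ-≤ (r v) (deg≤ v))) ⟩
      sum (λ v → r v * (b v + k)) + 2
        ≡⟨ cong (_+ 2) (trans (sum-cong-≗ (λ v → *-distribˡ-+ (r v) (b v) k))
                              (∑-distrib-+ (λ v → r v * b v) (λ v → r v * k))) ⟩
      sum (λ v → r v * b v) + sum (λ v → r v * k) + 2
        ≡⟨ cong (λ x → sum (λ v → r v * b v) + x + 2) (trans (sym (*-distribʳ-sum k r)) (*-comm t k)) ⟩
      sum (λ v → r v * b v) + k * t + 2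
        ≡⟨ rearr (sum (λ v → r v * b v)) (k * t) ⟩
      k * t + (sum (λ v → r v * b v) + 2)
        ≤⟨ +-monoʳ-≤ (k * t) many ⟩
      k * t + # used
        ≤⟨ +-monoʳ-≤ (k * t) (sum-mono-≤ pointwise) ⟩
      k * t + sum (λ j → small δ (class j) + big δ (class j))
        ≡⟨ cong (k * t +_) (∑-distrib-+ (small δ ∘ class) (big δ ∘ class)) ⟩
      k * t + (p + Q) ∎
      where
      open ≤-Reasoning
      rearr : ∀ x y → x + y + 2 ≡ y + (x + 2)
      rearr = solve-∀
      pointwise : ∀ j → ⟦ used j ⟧ ≤ small δ (class j) + big δ (class j)
      pointwise j with used j in uj
      ... | false = z≤n
      ... | true with kind δ (class j)
      ...   | is-empty c≡0 _ _ = contradiction c≡0 (>⇒≢ (used⇒inhabited j uj))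
      ...   | is-small _ _ s b rewrite s | b = ≤-refl
      ...   | is-big _ s b rewrite s | b = ≤-refl

    removed-degree-large : δ * t ≤ d
    removed-degree-large = ≤-trans (≤-reflexive (trans (*-comm δ t) (*-distribʳ-sum δ r)))
      (sum-mono-≤ (λ v → *-monoʳ-≤ (r v) (δ≤deg v)))

    sum-class-kinds : sum class ≡ p + suc δ * Q + E
    sum-class-kinds = trans (sum-cong-≗ (kind-decomposition δ ∘ class))
      (trans (∑-distrib-+₃ (small δ ∘ class) (λ j → suc δ * big δ (class j)) (excess δ ∘ class))
             (cong (λ x → p + x + E) (sym (*-distribˡ-sum (suc δ) (big δ ∘ class)))))

    sum-class-squares : sum (λ j → class j * class j) ≤
                        p + suc δ * suc δ * Q + 2 * suc δ * E + E * E
    sum-class-squares = begin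
      sum (λ j → class j * class j)
        ≤⟨ sum-mono-≤ (kind-square δ ∘ class) ⟩
      sum (λ j → s j + b₂ j + e₁ j + e₂ j)
        ≡⟨ trans (∑-distrib-+ (λ j → s j + b₂ j + e₁ j) e₂) (cong (_+ sum e₂) (∑-distrib-+₃ s b₂ e₁)) ⟩
      p + sum b₂ + sum e₁ + sum e₂
        ≤⟨ +-mono-≤ (≤-reflexive (cong₂ (λ x y → p + x + y)
             (sym (*-distribˡ-sum (suc δ * suc δ) (big δ ∘ class)))
             (sym (*-distribˡ-sum (2 * suc δ) (excess δ ∘ class))))) (sum-square (excess δ ∘ class)) ⟩
      p + suc δ * suc δ * Q + 2 * suc δ * E + E * E ∎
      where
      open ≤-Reasoning
      s b₂ e₁ e₂ : Fin labels → ℕ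
      s j = small δ (class j)
      b₂ j = suc δ * suc δ * big δ (class j)
      e₁ j = 2 * suc δ * excess δ (class j)
      e₂ j = excess δ (class j) * excess δ (class j)

    no-big-squares : Q ≡ 0 → sum (λ j → class j * class j) ≤ δ * sum class
    no-big-squares Q≡0 = ≤-trans (sum-mono-≤ pointwise) (≤-reflexive (sym (*-distribˡ-sum δ class)))
      where
      pointwise : ∀ j → class j * class j ≤ δ * class j
      pointwise j with kind δ (class j)
      ... | is-empty c≡0 _ _ rewrite c≡0 = z≤n
      ... | is-small _ c≤δ _ _ = *-monoˡ-≤ (class j) c≤δ
      ... | is-big _ _ b with () ← ≤-trans (≤-reflexive (sym b))
                                   (≤-trans (term≤sum (big δ ∘ class) j) (≤-reflexive Q≡0))

    barrier-size : ∀ {N′ : ℕ} → n ≡ suc D′ * δ + 1 + N′ → 2 * δ + 1 ≤ N′ →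
                   2 * size G + N′ < N′ * N′ + 2 * (suc D′ * δ + 1) * δ
    -- The split is on whether a big class exists; if so, one of them is set apart as the class to
    -- absorb the excess, leaving `q` others.
    barrier-size {N′} n≡ N′-large = go Q refl
      where
      order : t + sum class ≡ suc D′ * δ + 1 + N′
      order = trans order-split n≡
      go : ∀ q → Q ≡ q → 2 * size G + N′ < N′ * N′ + 2 * (suc D′ * δ + 1) * δ
      go zero Q≡0 = size-bound-small {k} {D′} {t} {p} order edge-count N′-large
        (≤-trans (m≤m+n p _) (≤-trans (m≤m+n _ E) (≤-reflexive (sym sum-class-kinds))))
        (no-big-squares Q≡0)
        (≤-trans removed-degree-bound (≤-reflexive (cong (k * t +_)
          (trans (cong (p +_) Q≡0) (+-identityʳ p)))))
      go (suc q) Q≡ = size-bound-big {k} {D′} {t} {p} order edge-count {q} {E}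
        (subst (λ Q → sum class ≡ p + suc δ * Q + E) Q≡ sum-class-kinds)
        (subst (λ Q → sum (λ j → class j * class j) ≤ p + suc δ * suc δ * Q + 2 * suc δ * E + E * E)
               Q≡ sum-class-squares)
        (subst (λ Q → δ * p + Q ≤ d) Q≡ boundary-bound)
        removed-degree-large
        (subst (λ Q → d + 2 ≤ k * t + (p + Q)) Q≡ removed-degree-bound)

-- The extremal graph

degree-sum : ∀ {n} → Graph n → ℕ
degree-sum G = sum (λ u → # (adj G u))

degree-sum-combine : ∀ c {m n} (G : Graph m) (H : Graph n) →
  degree-sum (Combine.combine c G H) ≡
  degree-sum G + m * (n * ⟦ c ⟧) + (n * (m * ⟦ c ⟧) + degree-sum H)
degree-sum-combine c {m} {n} G H = trans
  (sum-++ m (λ u → # (adj GH u)))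
  (cong₂ _+_
    (trans (sum-cong-≗ left) (trans (∑-distrib-+ (λ i → # (adj G i)) (λ _ → n * ⟦ c ⟧)) (cong (degree-sum G +_) (sum-const m _))))
    (trans (sum-cong-≗ right) (trans (∑-distrib-+ (λ _ → m * ⟦ c ⟧) (λ j → # (adj H j))) (cong (_+ degree-sum H) (sum-const n _)))))
  where
  GH : Graph (m + n)
  GH = Combine.combine c G H

  left : ∀ i → # (adj GH (i ↑ˡ n)) ≡ # (adj G i) + n * ⟦ c ⟧
  left i rewrite splitAt-↑ˡ m i n = trans (sum-++ m _) (cong₂ _+_
    (sum-cong-≗ (λ i′ → cong (λ s → ⟦ Combine.adj⊎ c G H (inj₁ i) s ⟧) (splitAt-↑ˡ m i′ n)))
    (trans (sum-cong-≗ (λ j → cong (λ s → ⟦ Combine.adj⊎ c G H (inj₁ i) s ⟧) (splitAt-↑ʳ m n j)))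
           (sum-const n ⟦ c ⟧)))

  right : ∀ j → # (adj GH (m ↑ʳ j)) ≡ m * ⟦ c ⟧ + # (adj H j)
  right j rewrite splitAt-↑ʳ m n j = trans (sum-++ m _) (cong₂ _+_
    (trans (sum-cong-≗ (λ i → cong (λ s → ⟦ Combine.adj⊎ c G H (inj₂ j) s ⟧) (splitAt-↑ˡ m i n)))
           (sum-const m ⟦ c ⟧))
    (sum-cong-≗ (λ j′ → cong (λ s → ⟦ Combine.adj⊎ c G H (inj₂ j) s ⟧) (splitAt-↑ʳ m n j′))))

degree-sum-K : ∀ m → degree-sum (K m) + m ≡ m * m
degree-sum-K m = begin
  degree-sum (K m) + m
    ≡⟨ cong (degree-sum (K m) +_) (trans (sum-const m 1) (*-identityʳ m)) ⟨
  degree-sum (K m) + sum {m} (λ _ → 1)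
    ≡⟨ ∑-distrib-+ (λ u → # (adj (K m) u)) (λ _ → 1) ⟨
  sum (λ u → # (adj (K m) u) + 1)
    ≡⟨ sum-cong-≗ row ⟩
  sum {m} (λ _ → m)
    ≡⟨ sum-const m m ⟩
  m * m ∎
  where
  open ≡-Reasoning
  one : ∀ b → ⟦ not b ⟧ + ⟦ b ⟧ ≡ 1
  one true = refl
  one false = refl
  row : ∀ u → # (adj (K m) u) + 1 ≡ m
  row u = begin
    # (adj (K m) u) + 1                        ≡⟨ cong (# (adj (K m) u) +_) (sum-𝟙≟ʳ u) ⟨
    # (adj (K m) u) + sum (λ v → 𝟙 (u ≟ v))    ≡⟨ ∑-distrib-+ (⟦_⟧ ∘ adj (K m) u) _ ⟨
    sum (λ v → ⟦ adj (K m) u v ⟧ + 𝟙 (u ≟ v))  ≡⟨ sum-cong-≗ (λ v → one (does (u ≟ v))) ⟩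
    sum {m} (λ _ → 1)                          ≡⟨ trans (sum-const m 1) (*-identityʳ m) ⟩
    m                                          ∎

extremal-size : ∀ δ m r → let N′ = δ + m in
  N′ * N′ + 2 * r * δ ≤ 2 * size (K δ ∨ (K m ∪ r · K 1)) + N′
extremal-size δ m r = begin
  (δ + m) * (δ + m) + 2 * r * δ
    ≡⟨ identity₁ δ m r ⟩
  δ * δ + m * m + 2 * δ * (m + r)
    ≡⟨ cong₂ (λ x y → x + y + 2 * δ * (m + r)) (degree-sum-K δ) (degree-sum-K m) ⟨
  a + δ + (b + m) + 2 * δ * (m + r)
    -- `c`, the degree sum of the isolated vertices, is carried along as a nonnegative term, which
    -- suits a lower bound.
    ≤⟨ m≤m+n _ c ⟩
  a + δ + (b + m) + 2 * δ * (m + r) + c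
    ≡⟨ identity₂ a δ b m r c ⟩
  a + δ * ((m + r * 1) * 1) + ((m + r * 1) * (δ * 1) + (b + m * (r * 1 * 0) + (r * 1 * (m * 0) + c))) + (δ + m)
    ≡⟨ cong (_+ (δ + m)) total ⟨
  2 * size (K δ ∨ (K m ∪ r · K 1)) + (δ + m) ∎
  where
  open ≤-Reasoning
  a b c : ℕ
  a = degree-sum (K δ)
  b = degree-sum (K m)
  c = degree-sum (r · K 1)
  total : 2 * size (K δ ∨ (K m ∪ r · K 1)) ≡
    a + δ * ((m + r * 1) * 1) + ((m + r * 1) * (δ * 1) + (b + m * (r * 1 * 0) + (r * 1 * (m * 0) + c)))
  total = trans (sym (handshake (K δ ∨ (K m ∪ r · K 1))))
    (trans (degree-sum-combine true (K δ) (K m ∪ r · K 1))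
           (cong (λ x → a + δ * ((m + r * 1) * 1) + ((m + r * 1) * (δ * 1) + x))
                 (degree-sum-combine false (K m) (r · K 1))))
  identity₁ : ∀ δ m r → (δ + m) * (δ + m) + 2 * r * δ ≡ δ * δ + m * m + 2 * δ * (m + r)
  identity₁ = solve-∀
  identity₂ : ∀ a δ b m r c → a + δ + (b + m) + 2 * δ * (m + r) + c ≡
    a + δ * ((m + r * 1) * 1) + ((m + r * 1) * (δ * 1) + (b + m * (r * 1 * 0) + (r * 1 * (m * 0) + c))) + (δ + m)
  identity₂ = solve-∀

-- Barriers against the size hypothesis

no-barrier : ∀ {k D′ n} (let δ = k + suc D′) (G : Graph n) {b : Fin n → ℕ} → Connected G →
  (∀ v → δ ≤ # (adj G v)) → (∀ v → # (adj G v) ≤ b v + k) →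
  δ * δ + 4 * δ + 6 ≤ n + k * k → size (extremal n k δ) ≤ size G → ¬ Barrier G b
no-barrier {k} {D′} {n} G connected δ≤deg deg≤ large size≥ B = <-irrefl refl (begin-strict
  2 * size G + N′                                  <⟨ barrier-size G B {k} {D′} connected δ≤deg deg≤ n≡ N′-large ⟩
  N′ * N′ + 2 * (D * δ + 1) * δ                    ≡⟨ cong₂ (λ N D → N * N + 2 * (D * δ + 1) * δ) N′≡ (sym δ∸k≡D) ⟩
  (δ + m) * (δ + m) + 2 * ((δ ∸ k) * δ + 1) * δ    ≤⟨ extremal-size δ m ((δ ∸ k) * δ + 1) ⟩
  2 * size (extremal n k δ) + (δ + m)              ≡⟨ cong (2 * size (extremal n k δ) +_) N′≡ ⟨
  2 * size (extremal n k δ) + N′                   ≤⟨ +-monoˡ-≤ N′ (*-monoʳ-≤ 2 size≥) ⟩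
  2 * size G + N′                                  ∎)
  where
  open ≤-Reasoning
  D δ N′ m : ℕ
  D = suc D′
  δ = k + D
  N′ = n ∸ (D * δ + 1)
  m = n ∸ (δ ∸ k + 1) * δ ∸ 1

  identity : ∀ k D → D * (k + D) + 1 + (2 * (k + D) + 1) + k * k + (k * D + 2 * (k + D) + 4) ≡
             (k + D) * (k + D) + 4 * (k + D) + 6
  identity = solve-∀

  -- Since δ² - k² = Dδ + kD, the bound δ² + 4δ - k² + 6 leaves this room with kD + 2δ + 4 to spare.
  room : D * δ + 1 + (2 * δ + 1) ≤ n
  room = +-cancelʳ-≤ (k * k) _ n (begin
    D * δ + 1 + (2 * δ + 1) + k * k                        ≤⟨ m≤m+n _ (k * D + 2 * δ + 4) ⟩
    D * δ + 1 + (2 * δ + 1) + k * k + (k * D + 2 * δ + 4)  ≡⟨ identity k D ⟩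
    δ * δ + 4 * δ + 6                                      ≤⟨ large ⟩
    n + k * k                                              ∎)

  n≡ : n ≡ D * δ + 1 + N′
  n≡ = sym (m+[n∸m]≡n (≤-trans (m≤m+n (D * δ + 1) (2 * δ + 1)) room))

  N′-large : 2 * δ + 1 ≤ N′
  N′-large = m+n≤o⇒m≤o∸n (2 * δ + 1) {D * δ + 1} (≤-trans (≤-reflexive (+-comm (2 * δ + 1) _)) room)

  δ∸k≡D : δ ∸ k ≡ D
  δ∸k≡D = m+n∸m≡n k D

  regroup : ∀ D δ → (D + 1) * δ + 1 ≡ D * δ + 1 + δ
  regroup = solve-∀

  m≡ : m ≡ N′ ∸ δ
  m≡ = begin-equality
    n ∸ (δ ∸ k + 1) * δ ∸ 1     ≡⟨ cong (λ x → n ∸ (x + 1) * δ ∸ 1) δ∸k≡D ⟩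
    n ∸ (D + 1) * δ ∸ 1         ≡⟨ ∸-+-assoc n ((D + 1) * δ) 1 ⟩
    n ∸ ((D + 1) * δ + 1)       ≡⟨ cong (n ∸_) (regroup D δ) ⟩
    n ∸ (D * δ + 1 + δ)         ≡⟨ ∸-+-assoc n (D * δ + 1) δ ⟨
    N′ ∸ δ                      ∎

  N′≡ : N′ ≡ δ + m
  N′≡ = sym (trans (cong (δ +_) m≡)
    (m+[n∸m]≡n (≤-trans (≤-trans (m≤m+n δ (δ + 0)) (m≤m+n (2 * δ) 1)) N′-large)))

-- The rational order bound and the conclusion

open import Data.Integer using (+_)

-- Rational division normalises through a gcd and does not reduce for variable `i`; among
-- unnormalised rationals the denominator 1 is literal.
/1-cancel-≤ : ∀ {i j} → i ℚ./ 1 ℚ.≤ j ℚ./ 1 → i ℤ.≤ j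
/1-cancel-≤ {i} {j} h = subst₂ ℤ._≤_ (ℤ.*-identityʳ i) (ℤ.*-identityʳ j)
  (ℚᵘ.drop-*≤* (ℚᵘ.≤-respˡ-≃ (ℚ.toℚᵘ-fromℚᵘ (mkℚᵘ i 0))
               (ℚᵘ.≤-respʳ-≃ (ℚ.toℚᵘ-fromℚᵘ (mkℚᵘ j 0)) (ℚ.toℚᵘ-mono-≤ h))))

order-large : ∀ {k δ n} (k<δ : k < δ) → orderBound k δ k<δ ℚ.≤ (+ n) ℚ./ 1 →
              δ * δ + 4 * δ + 6 ≤ n + k * k
order-large {k} {δ} {n} k<δ h = ℤ.drop‿+≤+ (begin
  + (δ * δ + 4 * δ + 6)
    ≡⟨ cong₂ (λ x y → x ℤ.+ y ℤ.+ + 6) (ℤ.pos-* δ δ) (ℤ.pos-* 4 δ) ⟩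
  + δ ℤ.* + δ ℤ.+ + 4 ℤ.* + δ ℤ.+ + 6
    ≡⟨ identity (+ δ) (+ k) ⟩
  b ℤ.+ + k ℤ.* + k
    ≤⟨ ℤ.+-monoˡ-≤ (+ k ℤ.* + k) (/1-cancel-≤ {b} {+ n} (ℚ.p⊔q≤r⇒q≤r ((a ℤ.* a) ℚ./ (6 * (δ ∸ k)) ℚ.+ (+ (δ + k + 1)) ℚ./ 1) (b ℚ./ 1) h)) ⟩
  + n ℤ.+ + k ℤ.* + k
    ≡⟨ cong (λ x → + n ℤ.+ x) (ℤ.pos-* k k) ⟨
  + (n + k * k) ∎)
  where
  open ℤ.≤-Reasoning
  instance
    6[δ∸k]≢0 : NonZero (6 * (δ ∸ k))
    6[δ∸k]≢0 = m*n≢0 6 (δ ∸ k) ⦃ _ ⦄ ⦃ >-nonZero (m<n⇒0<n∸m k<δ) ⦄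
  a b : ℤ
  a = + δ ℤ.* + δ ℤ.+ (+ 2 ℤ.- + k) ℤ.* + δ ℤ.- + 2 ℤ.* + k ℤ.- + 1
  b = + δ ℤ.* + δ ℤ.+ + 4 ℤ.* + δ ℤ.- + k ℤ.* + k ℤ.+ + 6
  identity : ∀ d κ → d ℤ.* d ℤ.+ + 4 ℤ.* d ℤ.+ + 6 ≡
             d ℤ.* d ℤ.+ + 4 ℤ.* d ℤ.- κ ℤ.* κ ℤ.+ + 6 ℤ.+ κ ℤ.* κ
  identity = ℤSolver.solve-∀

theorem1p2 : ∀ (k : ℕ) → k ≥ 2 → 2 ∣ k →
    ∀ (n : ℕ) (G : Graph n) → Connected G →
    ∀ (δ : ℕ) → IsMinDegree G δ →
    ∀ (δ≥k+1 : δ ≥ suc k) →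
    (+ n) ℚ./ 1 ℚ.≥ orderBound k δ δ≥k+1 →
    size G ≥ size (extremal n k δ) →
    ¬ (G ≅ extremal n k δ) →
    StrongParityProperty k G
theorem1p2 k 2≤k k-even n G connected δ (_ , min) k<δ order-bound size≥ _ X X-even
  -- Replaces δ by `k + suc D′`, so that δ - k is a visible successor and the arithmetic is free of
  -- truncated subtraction.
  with D′ , eq ← m≤n⇒∃[o]m+o≡n k<δ
  with refl ← trans (+-suc k D′) eq
  with δ≤deg ← (λ v → subst (δ ≤_) (∣tabulate∣ (adj G v)) (min v))
  with strong-parity-or-barrier G k-even (λ v → ≤-trans k<δ (δ≤deg v)) X X-even
... | inj₁ F = F
... | inj₂ B = contradiction B (no-barrier {k} {D′} G connected δ≤deg
  (deg≤surplus+k G k-even (λ v → ≤-trans k<δ (δ≤deg v)) X X-even (<⇒≤ 2≤k))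
  (order-large {k} {δ} k<δ order-bound) size≥)
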